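{- Let $\Sigma$ be a finite set of node labels. For a given top dag $D$ over $\Sigma$ one can compute in linear time an FSLP $F$ over $\Sigma$ such that $[\![F]\!]=[\![D]\!]$ and $|F|\in O(|D|)$.
   Context: **Trees and forests.** $\mathcal{F}_0(\Sigma)$ is the set of finite ordered $\Sigma$-labelled forests (possibly empty sequences of trees) and $\mathcal{T}_0(\Sigma)$ the set of ordered unranked $\Sigma$-labelled trees. Inductively: a sequence $t_1\cdots t_n$ ($n\ge 0$) of trees is a forest ($\varepsilon$ is the empty one), and $a(f)$ is a tree for $a\in\Sigma$ and $f$ a forest; $a()$ is also written $a$. Fix a parameter $x\notin\Sigma$. $\mathcal{F}_1(\Sigma)$ is the set of forests over $\Sigma\cup\{x\}$ in which $x$ occurs exactly once, at a leaf. $\mathcal{F}(\Sigma)=\mathcal{F}_0(\Sigma)\cup\mathcal{F}_1(\Sigma)$. **Straight-line programs (SLPs).** For an algebra with (possibly partial) operations $f_1,\dots,f_k$, an SLP is $P=(V,S,\rho)$ with $V$ a finite set of variables, $S\in V$ the start variable, and $\rho$ mapping each $A\in V$ to its right-hand side, an expression over the operations in which variables from $V$ may occur as atoms, such that the relation "$B$ occurs in $\rho(A)$" is acyclic. Each variable $A$ has a (possibly undefined) value $[\![A]\!]_P$ obtained by evaluating $\rho(A)$ recursively; $[\![P]\!]=[\![S]\!]_P$. $P$ is valid if all values are defined. The size $|P|$ is the total number of occurrences of operations (including constants) in all right-hand sides (this is the number of variables if every right-hand side is a single operation applied to variables). **FSLPs.** The forest algebra on $\mathcal{F}(\Sigma)$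 has operations: horizontal concatenation $fg$ (defined if at least one of $f,g$ is in $\mathcal{F}_0(\Sigma)$); vertical concatenation $f\langle g\rangle$ (defined if $f\in\mathcal{F}_1(\Sigma)$; replace $x$ in $f$ by $g$); the unary operations $f\mapsto a(f)$, $a\in\Sigma$; the constants $\varepsilon$ and $x$. An FSLP over $\Sigma$ is a valid SLP $F$ over this algebra with $[\![F]\!]\in\mathcal{F}_0(\Sigma)$. **Top dags.** A cluster of rank 0 is a tree in $\mathcal{T}_0(\Sigma)$ of size (number of nodes) at least 2; a cluster of rank 1 is such a tree with a distinguished leaf (bottom boundary node, underlined). The cluster algebra has constants $a(b)$ and $a(\underline{b})$ ($a,b\in\Sigma$); the horizontal merge of $s=a(f)$ and $t=a(g)$ (same root label, at most one of rank 1), which is $a(fg)$ with rank the sum of the ranks; and the vertical merge of $s$ and $t$ ($s$ of rank 1, root label of $t$ equal to the label of the bottom boundary node of $s$), obtained by replacing the bottom boundary node of $s$ by $t$, with the rank of $t$. A top dag over $\Sigma$ is an SLP $D$ over the cluster algebra with $[\![D]\!]\in\mathcal{T}_0(\Sigma)$ (i.e. of rank 0). -}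

module Defs where

open import Data.Bool.Base using (Bool; true; false; if_then_else_)
open import Data.Empty using (⊥)
open import Data.Fin.Base using (Fin; toℕ)
import Data.Fin.Properties as Fin
open import Data.List.Base
  using (List; []; _∷_; [_]; _++_; length; map; concatMap; allFin; lookup)
open import Data.List.Properties using (length-++; ++-assoc; ++-identityʳ)
open import Data.Maybe.Base using (Maybe; just; nothing)
open import Data.Nat.Base
  using (ℕ; suc; pred; _+_; _*_; _≤_; z≤n; s≤s; s≤s⁻¹; _≡ᵇ_; _<ᵇ_)
open import Data.Nat.ListAction using (sum)
open import Data.Nat.Properties
  using (_≟_; ≤-trans; ≤-refl; ≤-reflexive; m≤m+n; +-identityʳ; *-distribʳ-+)
open import Data.Product.Base using (∃; ∃-syntax; _×_; _,_)
open import Data.Sum.Base using (_⊎_; inj₁; inj₂)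
open import Data.Unit.Base using (⊤; tt)
open import Data.Vec.Base using (Vec; []; _∷_)
open import Data.Vec.Relation.Binary.Pointwise.Inductive using (Pointwise)
open import Data.Vec.Relation.Unary.Any using (Any)
open import Function.Base using (const)
open import Function.Bundles using (_↔_; Inverse)
open import Function.Properties.Inverse using (↔⇒↣)
open import Relation.Binary.Construct.Closure.Transitive using (TransClosure)
open import Relation.Binary.Definitions using (DecidableEquality)
open import Relation.Binary.PropositionalEquality
  using (_≡_; refl; sym; trans; cong; cong₂; subst)
open import Relation.Nullary.Decidable using (yes; no; via-injection; _⊎-dec_)
open import Relation.Nullary.Negation using (¬_)

------------------------------------------------------------------------
-- Ordered unranked trees

-- Nodes are labelled by L; in addition leaves may be marks from M:
--   M = ⊥ : trees over L;
--   M = ⊤ : the only mark is the parameter x;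
--   M = L : mark b is the underlined leaf b (a bottom boundary node).

data Tree (L M : Set) : Set where
  node : L → List (Tree L M) → Tree L M
  mark : M → Tree L M

Forest : Set → Set → Set
Forest L M = List (Tree L M)

T₀ F₀ : Set → Set
T₀ L = Tree L ⊥
F₀ L = Forest L ⊥

module _ {L M : Set} where

  mutual
    size : Tree L M → ℕ
    size (node a f) = suc (sizes f)
    size (mark m)   = 1

    sizes : Forest L M → ℕ
    sizes []      = 0
    sizes (t ∷ f) = size t + sizes f

  mutual
    marks : Tree L M → List M
    marks (node a f) = marks* f
    marks (mark m)   = [ m ]

    marks* : Forest L M → List M
    marks* []      = []
    marks* (t ∷ f) = marks t ++ marks* f

  rank : Tree L M → ℕ
  rank t = length (marks t)

  rank* : Forest L M → ℕ
  rank* f = length (marks* f)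

module _ {L M N : Set} where

  mutual
    plug : (M → Forest L N) → Tree L M → Forest L N
    plug σ (node a f) = [ node a (plug* σ f) ]
    plug σ (mark m)   = σ m

    plug* : (M → Forest L N) → Forest L M → Forest L N
    plug* σ []      = []
    plug* σ (t ∷ f) = plug σ t ++ plug* σ f

module _ {L M : Set} where

  mutual
    embed : T₀ L → Tree L M
    embed (node a f) = node a (embed* f)

    embed* : F₀ L → Forest L M
    embed* []      = []
    embed* (t ∷ f) = embed t ∷ embed* f

marks*-++ : ∀ {L M} (f g : Forest L M) → marks* (f ++ g) ≡ marks* f ++ marks* g
marks*-++ []      g = refl
marks*-++ (t ∷ f) g =
  trans (cong (marks t ++_) (marks*-++ f g))
        (sym (++-assoc (marks t) (marks* f) (marks* g)))

rank*-++ : ∀ {L M} (f g : Forest L M) → rank* (f ++ g) ≡ rank* f + rank* g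
rank*-++ f g = trans (cong length (marks*-++ f g)) (length-++ (marks* f))

rank*-++≤1 : ∀ {L M} (f g : Forest L M) → rank* f ≡ 0 ⊎ rank* g ≡ 0 →
             rank* f ≤ 1 → rank* g ≤ 1 → rank* (f ++ g) ≤ 1
rank*-++≤1 f g (inj₁ z) p q =
  subst (_≤ 1) (sym (trans (rank*-++ f g) (cong (_+ rank* g) z))) q
rank*-++≤1 f g (inj₂ z) p q =
  subst (_≤ 1) (sym (trans (rank*-++ f g)
                    (trans (cong (rank* f +_) z) (+-identityʳ (rank* f))))) p

module _ {L M N : Set} (g : Forest L N) where

  mutual
    rank-plug : (t : Tree L M) → rank* (plug (const g) t) ≡ rank t * rank* g
    rank-plug (node a f) =
      trans (cong length (++-identityʳ (marks* (plug* (const g) f)))) (rank-plug* f)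
    rank-plug (mark m)   = sym (+-identityʳ (rank* g))

    rank-plug* : (f : Forest L M) → rank* (plug* (const g) f) ≡ rank* f * rank* g
    rank-plug* []      = refl
    rank-plug* (t ∷ f) =
      trans (rank*-++ (plug (const g) t) (plug* (const g) f))
      (trans (cong₂ _+_ (rank-plug t) (rank-plug* f))
             (sym (trans (cong (_* rank* g) (length-++ (marks t)))
                         (*-distribʳ-+ (rank* g) (rank t) (rank* f)))))

rank-plug*-1 : ∀ {L M N} (f : Forest L M) (g : Forest L N) →
               rank* f ≡ 1 → rank* (plug* (const g) f) ≡ rank* g
rank-plug*-1 f g r =
  trans (rank-plug* g f) (trans (cong (_* rank* g) r) (+-identityʳ (rank* g)))

rank*-[] : ∀ {L M} (t : Tree L M) → rank* [ t ] ≡ rank t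
rank*-[] t = cong length (++-identityʳ (marks t))

0<size : ∀ {L M} (t : Tree L M) → 1 ≤ size t
0<size (node a f) = s≤s z≤n
0<size (mark m)   = s≤s z≤n

0<sizes-++ : ∀ {L M} (f g : Forest L M) → 1 ≤ sizes f → 1 ≤ sizes (f ++ g)
0<sizes-++ (t ∷ f) g _ = ≤-trans (0<size t) (m≤m+n (size t) _)

0<sizes-plug* : ∀ {L M N} (f : Forest L M) (t : Tree L N) →
                1 ≤ sizes f → 1 ≤ sizes (plug* (const [ t ]) f)
0<sizes-plug* (node a f ∷ h) t _ = s≤s z≤n
0<sizes-plug* (mark m ∷ h)   t _ = ≤-trans (0<size t) (m≤m+n (size t) _)

------------------------------------------------------------------------
-- Straight-line programs over algebras with partial operations

record PartialAlgebra : Set₁ where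
  field
    Carrier : Set
    Op      : ℕ → Set        -- indexed by arity
    apply   : ∀ {k} → Op k → Vec Carrier k → Maybe Carrier

data Expr (Op : ℕ → Set) (V : Set) : Set where
  var : V → Expr Op V
  op  : ∀ {k} → Op k → Vec (Expr Op V) k → Expr Op V

module _ {Op : ℕ → Set} {V : Set} where

  data _occursIn_ (v : V) : Expr Op V → Set where
    here  : v occursIn var v
    there : ∀ {k} {o : Op k} {es} → Any (v occursIn_) es → v occursIn op o es

  mutual
    ops : Expr Op V → ℕ
    ops (var v)   = 0
    ops (op o es) = suc (ops* es)

    ops* : ∀ {k} → Vec (Expr Op V) k → ℕ
    ops* []       = 0
    ops* (e ∷ es) = ops e + ops* es

record SLP (𝔸 : PartialAlgebra) : Set where
  open PartialAlgebra 𝔸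
  field
    #vars   : ℕ
    start   : Fin #vars
    rhs     : Fin #vars → Expr Op (Fin #vars)
    acyclic : ∀ A → ¬ TransClosure (λ B C → C occursIn rhs B) A A

  ∣_∣ : ℕ
  ∣_∣ = sum (map (λ A → ops (rhs A)) (allFin #vars))

  -- The graph of the partial evaluation function.
  data _⇓_ : Expr Op (Fin #vars) → Carrier → Set where
    var : ∀ {A v} → rhs A ⇓ v → var A ⇓ v
    op  : ∀ {k} {o : Op k} {es vs v} →
          Pointwise _⇓_ es vs → apply o vs ≡ just v → op o es ⇓ v

  Valid : Set
  Valid = ∀ A → ∃[ v ] (var A ⇓ v)

------------------------------------------------------------------------
-- Encoding of straight-line programs as sequences of numbers

-- The number of variables, the start variable, and then the right-hand sides
-- in postfix notation, each terminated by 0.  A variable is 1 followed by its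
-- index; the codes of operations must begin with a number ≥ 2.

module Encoding {𝔸 : PartialAlgebra}
                (code : ∀ {k} → PartialAlgebra.Op 𝔸 k → List ℕ) where
  open PartialAlgebra 𝔸 using (Op)

  mutual
    postfix : ∀ {n} → Expr Op (Fin n) → List ℕ
    postfix (var A)   = 1 ∷ toℕ A ∷ []
    postfix (op o es) = postfix* es ++ code o

    postfix* : ∀ {n k} → Vec (Expr Op (Fin n)) k → List ℕ
    postfix* []       = []
    postfix* (e ∷ es) = postfix e ++ postfix* es

  encode : SLP 𝔸 → List ℕ
  encode P = #vars ∷ toℕ start
           ∷ concatMap (λ A → postfix (rhs A) ++ [ 0 ]) (allFin #vars)
    where open SLP P

------------------------------------------------------------------------
-- The forest algebra, the cluster algebra, FSLPs and top dags over a finite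
-- set Σ of labels

module Labelled {Σ : Set} {n : ℕ} (labels : Σ ↔ Fin n) where

  _≟ˡ_ : DecidableEquality Σ
  _≟ˡ_ = via-injection (↔⇒↣ labels) Fin._≟_

  label : Σ → ℕ
  label a = toℕ (Inverse.to labels a)

  -- F₀(Σ) ∪ F₁(Σ): the rank is the number of occurrences of x.
  record 𝓕 : Set where
    constructor _,_
    field
      forest  : Forest Σ ⊤
      .rank≤1 : rank* forest ≤ 1

  data ForestOp : ℕ → Set where
    ε x   : ForestOp 0
    _⟨-⟩  : Σ → ForestOp 1
    ⊙ʰ ⊙ᵛ : ForestOp 2

  concatʰ : 𝓕 → 𝓕 → Maybe 𝓕
  concatʰ (f , p) (g , q) with (rank* f ≟ 0) ⊎-dec (rank* g ≟ 0)
  ... | yes z = just ((f ++ g) , rank*-++≤1 f g z p q)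
  ... | no _  = nothing

  concatᵛ : 𝓕 → 𝓕 → Maybe 𝓕
  concatᵛ (f , p) (g , q) with rank* f ≟ 1
  ... | yes r = just (plug* (const g) f , subst (_≤ 1) (sym (rank-plug*-1 f g r)) q)
  ... | no _  = nothing

  forestAlgebra : PartialAlgebra
  forestAlgebra = record { Carrier = 𝓕 ; Op = ForestOp ; apply = apply }
    where
    apply : ∀ {k} → ForestOp k → Vec 𝓕 k → Maybe 𝓕
    apply ⊙ʰ      (f ∷ g ∷ [])   = concatʰ f g
    apply ⊙ᵛ      (f ∷ g ∷ [])   = concatᵛ f g
    apply (a ⟨-⟩) ((f , p) ∷ []) =
      just ([ node a f ] , subst (_≤ 1) (sym (rank*-[] (node a f))) p)
    apply ε       []             = just ([] , z≤n)
    apply x       []             = just ([ mark tt ] , ≤-refl)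

  record Cluster : Set where
    field
      tree    : Tree Σ Σ
      .size≥2 : 2 ≤ size tree
      .rank≤1 : rank tree ≤ 1

  data ClusterOp : ℕ → Set where
    _⟨_⟩  : Σ → Σ → ClusterOp 0
    _⟨_⟩ᵇ : Σ → Σ → ClusterOp 0     -- a(b) with b underlined
    ⊙ʰ ⊙ᵛ : ClusterOp 2

  mergeʰ : Cluster → Cluster → Maybe Cluster
  mergeʰ record { tree = node a f ; size≥2 = s ; rank≤1 = p }
         record { tree = node b g ; rank≤1 = q }
    with a ≟ˡ b | (rank* f ≟ 0) ⊎-dec (rank* g ≟ 0)
  ... | yes _ | yes z = just record
    { tree   = node a (f ++ g)
    ; size≥2 = s≤s (0<sizes-++ f g (s≤s⁻¹ s))
    ; rank≤1 = rank*-++≤1 f g z p q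
    }
  ... | _ | _ = nothing
  mergeʰ _ _ = nothing     -- excluded by size≥2

  mergeᵛ : Cluster → Cluster → Maybe Cluster
  mergeᵛ record { tree = node a f ; size≥2 = s }
         record { tree = t@(node c g) ; rank≤1 = q }
    with marks* f in eq
  ... | [] = nothing
  ... | _ ∷ _ ∷ _ = nothing     -- excluded by rank≤1
  ... | b ∷ [] with c ≟ˡ b
  ...   | no _  = nothing
  ...   | yes _ = just record
    { tree   = node a (plug* (const [ t ]) f)
    ; size≥2 = s≤s (0<sizes-plug* f t (s≤s⁻¹ s))
    ; rank≤1 = ≤-trans (≤-reflexive (trans (rank-plug*-1 f [ t ] (cong length eq))
                                           (rank*-[] t))) q
    }
  mergeᵛ _ _ = nothing     -- excluded by size≥2

  clusterAlgebra : PartialAlgebra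
  clusterAlgebra = record { Carrier = Cluster ; Op = ClusterOp ; apply = apply }
    where
    apply : ∀ {k} → ClusterOp k → Vec Cluster k → Maybe Cluster
    apply (a ⟨ b ⟩) [] = just record
      { tree = node a [ node b [] ] ; size≥2 = ≤-refl ; rank≤1 = z≤n }
    apply (a ⟨ b ⟩ᵇ) [] = just record
      { tree = node a [ mark b ] ; size≥2 = ≤-refl ; rank≤1 = ≤-refl }
    apply ⊙ʰ (s ∷ t ∷ []) = mergeʰ s t
    apply ⊙ᵛ (s ∷ t ∷ []) = mergeᵛ s t

  record FSLP : Set where
    field
      slp : SLP forestAlgebra
    open SLP slp public
    field
      valid     : Valid
      value     : F₀ Σ
      result    : 𝓕
      evaluates : var start ⇓ result
      agrees    : 𝓕.forest result ≡ embed* value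

  record TopDag : Set where
    field
      slp : SLP clusterAlgebra
    open SLP slp public
    field
      value     : T₀ Σ
      result    : Cluster
      evaluates : var start ⇓ result
      agrees    : Cluster.tree result ≡ embed value

  forestCode : ∀ {k} → ForestOp k → List ℕ
  forestCode ε       = 2 ∷ []
  forestCode x       = 3 ∷ []
  forestCode (a ⟨-⟩) = 4 ∷ label a ∷ []
  forestCode ⊙ʰ      = 5 ∷ []
  forestCode ⊙ᵛ      = 6 ∷ []

  clusterCode : ∀ {k} → ClusterOp k → List ℕ
  clusterCode (a ⟨ b ⟩)  = 2 ∷ label a ∷ label b ∷ []
  clusterCode (a ⟨ b ⟩ᵇ) = 3 ∷ label a ∷ label b ∷ []
  clusterCode ⊙ʰ         = 4 ∷ []
  clusterCode ⊙ᵛ         = 5 ∷ []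

  encodeFSLP : FSLP → List ℕ
  encodeFSLP F = Encoding.encode {forestAlgebra} forestCode (FSLP.slp F)

  encodeTopDag : TopDag → List ℕ
  encodeTopDag D = Encoding.encode {clusterAlgebra} clusterCode (TopDag.slp D)

------------------------------------------------------------------------
-- Linear time on a random access machine

-- Structured programs for a RAM with unit-cost instructions, whose memory is
-- divided into arrays numbered 0, 1, 2, … (a program mentions finitely many).
-- A scalar variable is an array of which only one cell is used.  The only
-- arithmetic is ±1, so a computation of t steps produces only numbers in
-- O(t + largest input number): words of logarithmic length suffice, and unit
-- cost is adequate.

data Term : Set where
  lit     : ℕ → Term
  _!_     : ℕ → Term → Term
  inc dec : Term → Term

data Test : Set where
  _==_ _≺_ : Term → Term → Test

data Program : Set where
  skip         : Program
  _!_≔_        : ℕ → Term → Term → Program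
  _then_       : Program → Program → Program
  if_run_else_ : Test → Program → Program → Program
  while_run_   : Test → Program → Program

infix  9 _!_
infix  6 _==_ _≺_
infix  5 _!_≔_
infixr 4 _then_

Memory : Set
Memory = ℕ → ℕ → ℕ

term : Memory → Term → ℕ
term μ (lit k)   = k
term μ (a ! e)   = μ a (term μ e)
term μ (inc e)   = suc (term μ e)
term μ (dec e)   = pred (term μ e)

test : Memory → Test → Bool
test μ (e == f) = term μ e ≡ᵇ term μ f
test μ (e ≺ f)  = term μ e <ᵇ term μ f

write : Memory → ℕ → ℕ → ℕ → Memory
write μ a i v b j =
  if a ≡ᵇ b then (if i ≡ᵇ j then v else μ b j) else μ b j

-- ⟨ p , μ ⟩⇓[ t ] ν : started in μ, p halts after t steps in ν.  Terms have
-- constant size for a fixed program, so evaluating one is part of a step.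
data ⟨_,_⟩⇓[_]_ : Program → Memory → ℕ → Memory → Set where
  skip     : ∀ {μ} → ⟨ skip , μ ⟩⇓[ 1 ] μ
  assign   : ∀ {μ a e f} →
             ⟨ a ! e ≔ f , μ ⟩⇓[ 1 ] write μ a (term μ e) (term μ f)
  _then_   : ∀ {p q μ ν ξ s t} →
             ⟨ p , μ ⟩⇓[ s ] ν → ⟨ q , ν ⟩⇓[ t ] ξ →
             ⟨ p then q , μ ⟩⇓[ s + t ] ξ
  if-true  : ∀ {b p q μ ν t} → test μ b ≡ true →
             ⟨ p , μ ⟩⇓[ t ] ν → ⟨ if b run p else q , μ ⟩⇓[ suc t ] ν
  if-false : ∀ {b p q μ ν t} → test μ b ≡ false →
             ⟨ q , μ ⟩⇓[ t ] ν → ⟨ if b run p else q , μ ⟩⇓[ suc t ] ν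
  stop     : ∀ {b p μ} → test μ b ≡ false → ⟨ while b run p , μ ⟩⇓[ 1 ] μ
  loop     : ∀ {b p μ ν ξ s t} → test μ b ≡ true →
             ⟨ p , μ ⟩⇓[ s ] ν → ⟨ while b run p , ν ⟩⇓[ t ] ξ →
             ⟨ while b run p , μ ⟩⇓[ suc (s + t) ] ξ

_at_ : List ℕ → ℕ → ℕ
[]       at i     = 0
(w ∷ ws) at 0     = w
(w ∷ ws) at suc i = ws at i

-- The input is in array 0; all other cells are initially 0.
initial : List ℕ → Memory
initial ws 0       i = ws at i
initial ws (suc a) i = 0

-- The output is an initial segment of array 1.  (Encoded SLPs are
-- self-delimiting.)
_outputs_ : Memory → List ℕ → Set
μ outputs ws = (i : Fin (length ws)) → μ 1 (toℕ i) ≡ lookup ws i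

-- Given A one can compute in linear time a B related to it by R.
LinearTimeComputable : {A B : Set} → (A → List ℕ) → (B → List ℕ) →
                       (A → B → Set) → Set
LinearTimeComputable {A} {B} encodeᴬ encodeᴮ R =
  ∃[ p ] ∃[ c ] ∀ (a : A) → ∃[ b ] (R a b ×
    ∃[ t ] ∃[ μ ] (⟨ p , initial (encodeᴬ a) ⟩⇓[ t ] μ ×
                   t ≤ c * length (encodeᴬ a) ×
                   μ outputs encodeᴮ b))

{-# OPTIONS --safe #-}

-- Dropping the root of a cluster a(f), and replacing a boundary leaf b by b(x),
-- turns clusters into forests, horizontal and vertical merges into horizontal
-- and vertical concatenations, a(b) into b(ε) and a(b̲) into b(x).  In postfix
-- notation this acts on each token separately.  It remains to add a new start
-- variable a(S).  The root label a is read off the leftmost leaf, which is the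
-- first token of a right-hand side up to a chain of variables; by acyclicity
-- the chain is no longer than the number of variables.
--
-- A top dag may have undefined variables whereas an FSLP must be valid, so a
-- graph search determines the variables reachable from S, which are defined;
-- all others become aliases of S.  The search takes linear time because a
-- right-hand side is scanned only when its variable is taken from the stack.

module Submission where

open import Data.Bool.Base using (Bool; true; false; if_then_else_)
open import Data.Bool.Properties using (T-≡)
open import Data.Fin.Base as Fin using (Fin; zero; suc; toℕ)
open import Data.Fin.Properties as Fin using (pigeonhole; toℕ<n; toℕ-injective)
open import Data.List.Base
  using (List; []; _∷_; [_]; _++_; length; map; concatMap; tabulate; allFin; lookup)
open import Data.List.Properties
  using (++-assoc; ++-identityʳ; length-++; length-tabulate; map-tabulate
        ; concatMap-++; concatMap-cong; concatMap-map)
open import Data.List.Membership.Propositional using (_∈_)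
open import Data.List.Membership.Propositional.Properties
  using (∈-map⁺; ∈-allFin; ∈-++⁺ˡ; ∈-++⁺ʳ; ∈-++⁻)
open import Data.List.Relation.Unary.All using (All; []; _∷_)
open import Data.List.Relation.Unary.All.Properties using (++⁻ˡ; ++⁻ʳ)
open import Data.List.Relation.Unary.Any using (here; there)
open import Data.Maybe.Base using (just)
open import Data.Nat.Base
open import Data.Nat.ListAction using (sum)
open import Data.Nat.Properties as ℕ hiding (_≟_)
open import Data.Nat.Tactic.RingSolver using (solve-∀)
open import Data.Product.Base using (∃; ∃₂; ∃-syntax; _×_; _,_; proj₁; proj₂)
open import Data.Sum.Base as Sum using (_⊎_; inj₁; inj₂)
open import Data.Unit.Base using (⊤; tt)
open import Data.Vec.Base using (Vec; []; _∷_)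
open import Data.Vec.Relation.Binary.Pointwise.Inductive using (Pointwise; []; _∷_)
open import Data.Vec.Relation.Unary.Any using (Any; here; there)
open import Function.Base using (const; _∘_; id; _∋_)
open import Function.Bundles using (_↔_; Equivalence)
open import Relation.Binary.Construct.Closure.Transitive using (TransClosure; _∷_)
open import Relation.Binary.PropositionalEquality
  using (_≡_; _≢_; refl; sym; trans; cong; cong₂; cong-app; subst; subst₂
        ; module ≡-Reasoning)
open import Relation.Nullary.Decidable using (yes; no; _⊎-dec_)
open import Relation.Nullary.Negation using (¬_; contradiction)
open import Defs

-- Trees and clusters

-- The FSLP is not fixed before the run: it is built from whatever the array of links holds when the
-- search stops. All that is asked of the seen variables is that they contain the start, are closed
-- under occurrence and are defined. The machine never tests definedness. It is inherited from the
-- given evaluation of S, because a derivation for an expression contains one for each of its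
-- variables.
--
-- Every scan of a right-hand side costs a constant per token, and the end marker 0 pays for the
-- constant cost per variable. The search meets the right-hand sides in an order unrelated to the
-- input, so its cost is charged to a potential: the weights of the unseen variables plus those of
-- the variables on the stack.

∈⇒≤sum : ∀ {m ms} → m ∈ ms → m ≤ sum ms
∈⇒≤sum {ms = m ∷ ms} (here refl) = m≤m+n m (sum ms)
∈⇒≤sum {ms = k ∷ ms} (there i)   = ≤-trans (∈⇒≤sum i) (m≤n+m (sum ms) k)

sum-map-≤ : ∀ {A : Set} {f g : A → ℕ} k → (∀ x → f x ≤ k * g x) →
            ∀ xs → sum (map f xs) ≤ k * sum (map g xs)
sum-map-≤ k f≤kg []       = z≤n
sum-map-≤ {g = g} k f≤kg (x ∷ xs) =
  ≤-trans (+-mono-≤ (f≤kg x) (sum-map-≤ k f≤kg xs))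
          (≤-reflexive (sym (*-distribˡ-+ k (g x) _)))

module _ {L M N : Set} (σ : M → Forest L N) where

  plug*-++ : ∀ f g → plug* σ (f ++ g) ≡ plug* σ f ++ plug* σ g
  plug*-++ []      g = refl
  plug*-++ (t ∷ f) g = trans (cong (plug σ t ++_) (plug*-++ f g))
                             (sym (++-assoc (plug σ t) (plug* σ f) (plug* σ g)))

  mutual
    plug-embed : ∀ t → plug σ (embed t) ≡ [ embed t ]
    plug-embed (node a f) = cong (λ g → [ node a g ]) (plug*-embed* f)

    plug*-embed* : ∀ f → plug* σ (embed* f) ≡ embed* f
    plug*-embed* []      = refl
    plug*-embed* (t ∷ f) = cong₂ _++_ (plug-embed t) (plug*-embed* f)

  module _ (τ : M → Forest L N) where
    mutual
      -- Agreement is required only on marks that occur. For the upper argument of a vertical merge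
      -- that is a single label, which is what `expose-plug*` exploits.
      plug-cong : ∀ t → All (λ m → σ m ≡ τ m) (marks t) → plug σ t ≡ plug τ t
      plug-cong (node a f) eqs      = cong (λ g → [ node a g ]) (plug*-cong f eqs)
      plug-cong (mark m)   (eq ∷ _) = eq

      plug*-cong : ∀ f → All (λ m → σ m ≡ τ m) (marks* f) → plug* σ f ≡ plug* τ f
      plug*-cong []      eqs = refl
      plug*-cong (t ∷ f) eqs = cong₂ _++_ (plug-cong t (++⁻ˡ (marks t) eqs))
                                          (plug*-cong f (++⁻ʳ (marks t) eqs))

module _ {L M N K : Set} (σ : M → Forest L N) (τ : N → Forest L K) where

  mutual
    -- Associativity of substitution, with `plug` read as the bind of a monad.
    plug-plug : ∀ t → plug* τ (plug σ t) ≡ plug (plug* τ ∘ σ) t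
    plug-plug (node a f) = cong (λ g → [ node a g ]) (plug*-plug* f)
    plug-plug (mark m)   = refl

    plug*-plug* : ∀ f → plug* τ (plug* σ f) ≡ plug* (plug* τ ∘ σ) f
    plug*-plug* []      = refl
    plug*-plug* (t ∷ f) = trans (plug*-++ τ (plug σ t) (plug* σ f))
                                (cong₂ _++_ (plug-plug t) (plug*-plug* f))

-- The root of a vertical merge's lower argument is dropped by the translation,
-- so the boundary node b of the upper argument becomes b(x).
expose : ∀ {L} → Forest L L → Forest L ⊤
expose = plug* (λ b → [ node b [ mark tt ] ])

mutual
  rank-expose : ∀ {L} (t : Tree L L) →
                rank* (plug (λ b → [ node b [ mark tt ] ]) t) ≡ rank t
  rank-expose (node a f) =
    trans (rank*-[] (node a (expose f))) (rank*-expose f)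
  rank-expose (mark b)   = refl

  rank*-expose : ∀ {L} (f : Forest L L) → rank* (expose f) ≡ rank* f
  rank*-expose []      = refl
  rank*-expose (t ∷ f) =
    trans (rank*-++ (plug _ t) (expose f))
    (trans (cong₂ _+_ (rank-expose t) (rank*-expose f))
           (sym (length-++ (marks t))))

-- Vertical merge becomes vertical concatenation. Both sides are a single substitution into `f`: the
-- left one puts a node labelled `c` at every mark, the right one a node labelled by the mark
-- itself. They agree because `c` is the only mark.
expose-plug* : ∀ {L} (c : L) (g f : Forest L L) → marks* f ≡ [ c ] →
               expose (plug* (const [ node c g ]) f) ≡
               plug* (const (expose g)) (expose f)
expose-plug* c g f eq = begin
  expose (plug* (const [ node c g ]) f)          ≡⟨ plug*-plug* _ _ f ⟩
  plug* (const [ node c (expose g) ]) f          ≡⟨ plug*-cong _ _ f all-c ⟩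
  plug* (λ b → [ node b (expose g ++ []) ]) f    ≡⟨ plug*-plug* _ _ f ⟨
  plug* (const (expose g)) (expose f)            ∎
  where
  open ≡-Reasoning
  all-c : All (λ b → [ node c (expose g) ] ≡ [ node b (expose g ++ []) ]) (marks* f)
  -- The trailing `[]` comes from plugging `expose g` into the one-element forest `[ mark tt ]`.
  all-c = subst (All _) (sym eq) (cong (λ h → [ node c h ]) (sym (++-identityʳ _)) ∷ [])

children : ∀ {L M} → Tree L M → Forest L M
children (node a f) = f
children (mark m)   = []

embed-children : ∀ {L M} {t : T₀ L} {a} {f : Forest L M} → embed t ≡ node a f →
                 t ≡ node a (children t) × f ≡ embed* (children t)
embed-children {t = node a f} refl = refl , refl

-- Translation of clusters and right-hand sides into the forest algebra.

module Translation {Σ : Set} {n : ℕ} (labels : Σ ↔ Fin n) where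
  open Labelled labels

  -- An equation between whole trees: it also excludes a bare mark and can be used directly for
  -- rewriting.
  Rooted : Σ → Cluster → Set
  Rooted a s = Cluster.tree s ≡ node a (children (Cluster.tree s))

  inner : Cluster → Forest Σ Σ
  inner s = children (Cluster.tree s)

  -- Inversion of a defined merge. The components serve, in order, the definedness of the
  -- concatenation, its value, and the search for the root label.
  mergeʰ-just : ∀ s t {u} → mergeʰ s t ≡ just u →
                (rank* (inner s) ≡ 0 ⊎ rank* (inner t) ≡ 0) ×
                inner u ≡ inner s ++ inner t ×
                (∀ {a} → Rooted a s → Rooted a u)
  mergeʰ-just record { tree = node a f } record { tree = node b g } eq
    with a ≟ˡ b | (rank* f ℕ.≟ 0) ⊎-dec (rank* g ℕ.≟ 0)
  mergeʰ-just record { tree = node a f } record { tree = node b g } refl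
    | yes _ | yes z = z , refl , λ { refl → refl }
  mergeʰ-just record { tree = node a f } record { tree = node b g } () | yes _ | no _
  mergeʰ-just record { tree = node a f } record { tree = node b g } () | no _ | _
  mergeʰ-just record { tree = node a f } record { tree = mark m } ()
  mergeʰ-just record { tree = mark m } record { tree = node b g } ()
  mergeʰ-just record { tree = mark m } record { tree = mark m′ } ()

  -- mergeᵛ is defined by "with marks* f in eq", and its unfolding contains the
  -- proof refl : marks* f ≡ marks* f, of which only the right-hand side may be
  -- abstracted.  Writing f as h u on one side and h v on the other, with u and v
  -- definitionally but not syntactically equal, keeps the two sides apart.
  mergeᵛ-node : ∀ (u v : ⊤) (h : ⊤ → Forest Σ Σ) {a} {t w} .{i j} →
                mergeᵛ record { tree = node a (h u) ; size≥2 = i ; rank≤1 = j } t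
                  ≡ just w →
                ∃[ c ] (Rooted c t × marks* (h v) ≡ [ c ] ×
                Cluster.tree w ≡ node a (plug* (const [ node c (inner t) ]) (h u)))
  mergeᵛ-node u v h {t = record { tree = node c g }} eq
    with marks* (h u) | (marks* (h v) ≡ marks* (h u) ∋ refl)
  mergeᵛ-node u v h {t = record { tree = node c g }} () | [] | _
  mergeᵛ-node u v h {t = record { tree = node c g }} () | _ ∷ _ ∷ _ | _
  mergeᵛ-node u v h {t = record { tree = node c g }} eq | b ∷ [] | eqm
    with c ≟ˡ b
  mergeᵛ-node u v h {t = record { tree = node c g }} refl | b ∷ [] | eqm
    | yes refl = c , refl , eqm , refl
  mergeᵛ-node u v h {t = record { tree = node c g }} () | b ∷ [] | _ | no _
  mergeᵛ-node u v h {t = record { tree = mark m }} ()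

  mergeᵛ-just : ∀ s t {u} → mergeᵛ s t ≡ just u →
                ∃[ c ] (Rooted c t × marks* (inner s) ≡ [ c ] ×
                inner u ≡ plug* (const [ node c (inner t) ]) (inner s) ×
                (∀ {a} → Rooted a s → Rooted a u))
  mergeᵛ-just record { tree = node a f } t eq
    with c , r , m , e ← mergeᵛ-node tt tt (const f) {t = t} eq =
    c , r , m , cong children e ,
    λ { refl → trans e (cong (λ h → node a (children h)) (sym e)) }
  mergeᵛ-just record { tree = mark m } record { tree = node b g } ()
  mergeᵛ-just record { tree = mark m } record { tree = mark m′ } ()

  concatʰ-just : ∀ u v → let open 𝓕 in
                 rank* (forest u) ≡ 0 ⊎ rank* (forest v) ≡ 0 →
                 ∃[ w ] (concatʰ u v ≡ just w × forest w ≡ forest u ++ forest v)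
  concatʰ-just (f , _) (g , _) z
    with (rank* f ℕ.≟ 0) ⊎-dec (rank* g ℕ.≟ 0)
  ... | yes _ = _ , refl , refl
  ... | no ¬z = contradiction z ¬z

  concatᵛ-just : ∀ u v → let open 𝓕 in rank* (forest u) ≡ 1 →
                 ∃[ w ] (concatᵛ u v ≡ just w ×
                         forest w ≡ plug* (const (forest v)) (forest u))
  concatᵛ-just (f , _) (g , _) r with rank* f ℕ.≟ 1
  ... | yes _ = _ , refl , refl
  ... | no ¬r = contradiction r ¬r

  Exprᶜ Exprᶠ : ℕ → Set
  Exprᶜ N = Expr ClusterOp (Fin N)
  Exprᶠ N = Expr ForestOp (Fin N)

  -- Variable zero of the FSLP is the new start variable; the others are shifted.
  translate : ∀ {N} → Exprᶜ N → Exprᶠ (suc N)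
  translate (var A)                = var (suc A)
  translate (op (a ⟨ b ⟩) [])      = op (b ⟨-⟩) (op ε [] ∷ [])
  translate (op (a ⟨ b ⟩ᵇ) [])     = op (b ⟨-⟩) (op x [] ∷ [])
  translate (op ⊙ʰ (d ∷ e ∷ []))   = op ⊙ʰ (translate d ∷ translate e ∷ [])
  translate (op ⊙ᵛ (d ∷ e ∷ []))   = op ⊙ᵛ (translate d ∷ translate e ∷ [])

  ops-merge : ∀ i j {k l} → k ≤ 2 * i → l ≤ 2 * j →
              suc (k + (l + 0)) ≤ 2 * suc (i + (j + 0))
  ops-merge i j {k} {l} p q = begin
    suc (k + (l + 0))          ≤⟨ s≤s (+-mono-≤ p (+-monoˡ-≤ 0 q)) ⟩
    suc (2 * i + (2 * j + 0))  ≤⟨ n≤1+n _ ⟩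
    2 + (2 * i + (2 * j + 0))  ≡⟨ arith i j ⟩
    2 * suc (i + (j + 0))      ∎
    where
    open ≤-Reasoning
    arith : ∀ i j → 2 + (2 * i + (2 * j + 0)) ≡ 2 * suc (i + (j + 0))
    arith = solve-∀

  -- The factor 2 is attained at leaves, where one constant becomes a unary operation applied to a
  -- constant. A merge becomes just one concatenation.
  ops-translate : ∀ {N} (e : Exprᶜ N) → ops (translate e) ≤ 2 * ops e
  ops-translate (var A)              = z≤n
  ops-translate (op (a ⟨ b ⟩) [])    = ≤-refl
  ops-translate (op (a ⟨ b ⟩ᵇ) [])   = ≤-refl
  ops-translate (op ⊙ʰ (d ∷ e ∷ [])) =
    ops-merge (ops d) (ops e) (ops-translate d) (ops-translate e)
  ops-translate (op ⊙ᵛ (d ∷ e ∷ [])) =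
    ops-merge (ops d) (ops e) (ops-translate d) (ops-translate e)

  occursIn-translate : ∀ {N} (e : Exprᶜ N) {A} → A occursIn translate e →
                       ∃[ B ] (A ≡ suc B × B occursIn e)
  occursIn-translate (var B) here = B , refl , here
  occursIn-translate (op (a ⟨ b ⟩) []) (there (here (there ())))
  occursIn-translate (op (a ⟨ b ⟩ᵇ) []) (there (here (there ())))
  occursIn-translate (op ⊙ʰ (d ∷ e ∷ [])) (there (here i))
    with B , eq , j ← occursIn-translate d i = B , eq , there (here j)
  occursIn-translate (op ⊙ʰ (d ∷ e ∷ [])) (there (there (here i)))
    with B , eq , j ← occursIn-translate e i = B , eq , there (there (here j))
  occursIn-translate (op ⊙ᵛ (d ∷ e ∷ [])) (there (here i))
    with B , eq , j ← occursIn-translate d i = B , eq , there (here j)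
  occursIn-translate (op ⊙ᵛ (d ∷ e ∷ [])) (there (there (here i)))
    with B , eq , j ← occursIn-translate e i = B , eq , there (there (here j))

  -- Merging keeps the root of the left argument.
  leftmost : ∀ {N} → Exprᶜ N → Fin N ⊎ Σ
  leftmost (var B)            = inj₁ B
  leftmost (op (a ⟨ b ⟩) [])  = inj₂ a
  leftmost (op (a ⟨ b ⟩ᵇ) []) = inj₂ a
  leftmost (op ⊙ʰ (e ∷ _))    = leftmost e
  leftmost (op ⊙ᵛ (e ∷ _))    = leftmost e

  leftmost-occursIn : ∀ {N} (e : Exprᶜ N) {B} → leftmost e ≡ inj₁ B → B occursIn e
  leftmost-occursIn (var B)         refl = here
  leftmost-occursIn (op (a ⟨ b ⟩) []) ()
  leftmost-occursIn (op (a ⟨ b ⟩ᵇ) []) ()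
  leftmost-occursIn (op ⊙ʰ (e ∷ _)) eq   = there (here (leftmost-occursIn e eq))
  leftmost-occursIn (op ⊙ᵛ (e ∷ _)) eq   = there (here (leftmost-occursIn e eq))

  0<ops : ∀ {N} (e : Exprᶜ N) {a} → leftmost e ≡ inj₂ a → 1 ≤ ops e
  0<ops (op _ _) _ = s≤s z≤n

  Represents : 𝓕 → Cluster → Set
  Represents w v = 𝓕.forest w ≡ expose (inner v)

  rank-represents : ∀ w v {k} → Represents w v → rank* (inner v) ≡ k →
                    rank* (𝓕.forest w) ≡ k
  rank-represents w v r z = trans (cong rank* r) (trans (rank*-expose (inner v)) z)

  -- Root labels and the FSLP of a top dag.

  module FromTopDag (D : SLP clusterAlgebra) where
    open SLP D
    open PartialAlgebra clusterAlgebra using (apply)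

    Defined : Fin #vars → Set
    Defined A = ∃[ v ] (rhs A ⇓ v)

    -- `k` only bounds the number of `follow` steps, as `found` is available at every `k`. It
    -- becomes the running time of `chaseLoop`.
    data RootIn : ℕ → Fin #vars → Σ → Set where
      found  : ∀ {k A a} → leftmost (rhs A) ≡ inj₂ a → RootIn k A a
      follow : ∀ {k A B a} → leftmost (rhs A) ≡ inj₁ B → RootIn k B a →
               RootIn (suc k) A a

    Edge : Fin #vars → Fin #vars → Set
    Edge A B = B occursIn rhs A

    -- The path followed in vain is returned as a function on `Fin (suc k)`, ready for `pigeonhole`.
    -- Its edges are already closed under transitivity, so a repetition is at once a cycle.
    root-or-chain : ∀ k A → (∃[ a ] RootIn k A a) ⊎
      (∃ λ (f : Fin (suc k) → Fin #vars) → f zero ≡ A ×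
        (∀ {i j} → i Fin.< j → TransClosure Edge (f i) (f j)))
    root-or-chain k A with leftmost (rhs A) in eq
    ... | inj₂ a = inj₁ (a , found eq)
    root-or-chain zero A | inj₁ B =
      inj₂ (const A , refl , λ { {zero} {zero} () ; {suc ()} })
    root-or-chain (suc k) A | inj₁ B with root-or-chain k B
    ... | inj₁ (a , r) = inj₁ (a , follow eq r)
    ... | inj₂ (f , f₀≡B , chain) = inj₂ (g , refl , chain′)
      where
      g : Fin (suc (suc k)) → Fin #vars
      g zero    = A
      g (suc i) = f i
      A→B : Edge A (f zero)
      A→B = subst (Edge A) (sym f₀≡B) (leftmost-occursIn (rhs A) eq)
      chain′ : ∀ {i j} → i Fin.< j → TransClosure Edge (g i) (g j)
      chain′ {zero}  {suc zero}    _   = TransClosure.[_] A→B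
      chain′ {zero}  {suc (suc j)} _   = A→B ∷ chain {zero} {suc j} (s≤s z≤n)
      chain′ {suc i} {suc j}       i<j = chain (s≤s⁻¹ i<j)

    -- By the pigeonhole principle a longer chain would contain a cycle.
    root : ∀ A → ∃[ a ] RootIn #vars A a
    root A with root-or-chain #vars A
    ... | inj₁ r = r
    ... | inj₂ (f , _ , chain) with i , j , i<j , eq ← pigeonhole (n<1+n #vars) f =
      contradiction (subst (TransClosure Edge (f i)) (sym eq) (chain i<j)) (acyclic (f i))

    -- The second component extracts the evaluation of the leftmost variable from the derivation, so
    -- that `rooted` can continue there although `D` need not be valid.
    rooted-leftmost : ∀ {e v} → e ⇓ v →
      (∀ {a} → leftmost e ≡ inj₂ a → Rooted a v) ×
      (∀ {B} → leftmost e ≡ inj₁ B →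
        ∃[ u ] (rhs B ⇓ u × (∀ {a} → Rooted a u → Rooted a v)))
    rooted-leftmost (var d) = (λ ()) , λ { refl → _ , d , id }
    rooted-leftmost (op {o = a ⟨ b ⟩} [] refl)  = (λ { refl → refl }) , λ ()
    rooted-leftmost (op {o = a ⟨ b ⟩ᵇ} [] refl) = (λ { refl → refl }) , λ ()
    rooted-leftmost (op {o = ⊙ʰ} {vs = s ∷ t ∷ []} (d ∷ _ ∷ []) eq)
      with _ , _ , keep ← mergeʰ-just s t eq | leaf , variable′ ← rooted-leftmost d =
      (λ l → keep (leaf l)) ,
      λ l → let u , d′ , k = variable′ l in u , d′ , λ r → keep (k r)
    rooted-leftmost (op {o = ⊙ᵛ} {vs = s ∷ t ∷ []} (d ∷ _ ∷ []) eq)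
      with _ , _ , _ , _ , keep ← mergeᵛ-just s t eq | leaf , variable′ ← rooted-leftmost d =
      (λ l → keep (leaf l)) ,
      λ l → let u , d′ , k = variable′ l in u , d′ , λ r → keep (k r)

    rooted : ∀ {k A a v} → RootIn k A a → rhs A ⇓ v → Rooted a v
    rooted (found l)    d = proj₁ (rooted-leftmost d) l
    rooted (follow l r) d with u , d′ , keep ← proj₂ (rooted-leftmost d) l =
      keep (rooted r d′)

    -- Right-hand sides that are mere variables count 0, but the root search ends in one that
    -- contains a constant.
    0<∣D∣ : ∀ {k A a} → RootIn k A a → 1 ≤ ∣_∣
    0<∣D∣ {A = A} (found l)  =
      ≤-trans (0<ops (rhs A) l) (∈⇒≤sum (∈-map⁺ (ops ∘ rhs) (∈-allFin A)))
    0<∣D∣ (follow _ r) = 0<∣D∣ r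

    module FSLPOf (root-label : Σ) (unseen : Fin #vars → Bool)
      (seen-start : unseen start ≡ false)
      (seen-closed : ∀ {A B} → unseen A ≡ false → B occursIn rhs A → unseen B ≡ false)
      (seen-defined : ∀ {A} → unseen A ≡ false → Defined A) where

      Seen : Fin #vars → Set
      Seen A = unseen A ≡ false

      -- Unseen variables may be undefined in D; they become aliases of start,
      -- which costs no operation.
      rhsᶠ : Fin (suc #vars) → Exprᶠ (suc #vars)
      rhsᶠ zero    = op (root-label ⟨-⟩) (var (suc start) ∷ [])
      rhsᶠ (suc A) = if unseen A then var (suc start) else translate (rhs A)

      Edgeᶠ : Fin (suc #vars) → Fin (suc #vars) → Set
      Edgeᶠ A B = B occursIn rhsᶠ A

      -- Edges lead only to seen variables, never to variable zero or to an alias. Hence a cycle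
      -- would run through seen variables only, and would be a cycle of `D`.
      edgeᶠ-seen : ∀ {A C} → Edgeᶠ A C → ∃[ B ] (C ≡ suc B × Seen B)
      edgeᶠ-seen {zero} (there (here here)) = start , refl , seen-start
      edgeᶠ-seen {suc A} e with unseen A in s
      edgeᶠ-seen {suc A} here | true = start , refl , seen-start
      edgeᶠ-seen {suc A} e | false with B , eq , e′ ← occursIn-translate (rhs A) e =
        B , eq , seen-closed s e′

      edgeᶠ-edge : ∀ {A B} → Seen A → Edgeᶠ (suc A) (suc B) → Edge A B
      edgeᶠ-edge {A} s e with unseen A
      edgeᶠ-edge {A} refl e | false with _ , refl , e′ ← occursIn-translate (rhs A) e = e′

      pathᶠ-path : ∀ {A B} → Seen A → TransClosure Edgeᶠ (suc A) (suc B) →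
                   TransClosure Edge A B
      pathᶠ-path s TransClosure.[ e ] = TransClosure.[ edgeᶠ-edge s e ]
      pathᶠ-path s (e ∷ p) with B , refl , s′ ← edgeᶠ-seen e =
        edgeᶠ-edge s e ∷ pathᶠ-path s′ p

      pathᶠ-seen : ∀ {A C} → TransClosure Edgeᶠ A C → ∃[ B ] (C ≡ suc B × Seen B)
      pathᶠ-seen {A} TransClosure.[ e ] = edgeᶠ-seen {A} e
      pathᶠ-seen (_ ∷ p)                = pathᶠ-seen p

      slpᶠ : SLP forestAlgebra
      slpᶠ = record
        { #vars = suc #vars ; start = zero ; rhs = rhsᶠ ; acyclic = acyclicᶠ }
        where
        acyclicᶠ : ∀ A → ¬ TransClosure Edgeᶠ A A
        acyclicᶠ A p with B , refl , s ← pathᶠ-seen p = acyclic B (pathᶠ-path s p)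

      _⇓ᶠ_ : Exprᶠ (suc #vars) → 𝓕 → Set
      _⇓ᶠ_ = SLP._⇓_ slpᶠ

      -- Induction on the evaluation in `D`. Each concatenation is defined because the matching
      -- merge is, `expose` being rank-preserving.
      simulate : ∀ {e v} → (∀ {B} → B occursIn e → Seen B) → e ⇓ v →
                 ∃[ w ] (translate e ⇓ᶠ w × Represents w v)
      simulate seen (var {A} d) with unseen A in s
        | simulate (seen-closed (seen here)) d
      ... | true | _ with () ← trans (sym s) (seen here)
      ... | false | w , d′ , r =
        w ,
        SLP.var (subst (λ b → (if b then var (suc start) else translate (rhs A)) ⇓ᶠ w)
                       (sym s) d′) ,
        r
      simulate seen (op {o = a ⟨ b ⟩} [] refl) =
        _ , SLP.op (SLP.op [] refl ∷ []) refl , refl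
      simulate seen (op {o = a ⟨ b ⟩ᵇ} [] refl) =
        _ , SLP.op (SLP.op [] refl ∷ []) refl , refl
      simulate seen (op {o = ⊙ʰ} {vs = s ∷ t ∷ []} (d ∷ e ∷ []) eq)
        with u , d′ , rs ← simulate (λ i → seen (there (here i))) d
           | v , e′ , rt ← simulate (λ i → seen (there (there (here i)))) e
           | z , eq′ , _ ← mergeʰ-just s t eq
        with w , eqʷ , r ← concatʰ-just u v
               (Sum.map (rank-represents u s rs) (rank-represents v t rt) z) =
        w , SLP.op (d′ ∷ e′ ∷ []) eqʷ ,
        trans r (trans (cong₂ _++_ rs rt)
                (trans (sym (plug*-++ _ (inner s) (inner t))) (cong expose (sym eq′))))
      simulate seen (op {o = ⊙ᵛ} {vs = s ∷ t ∷ []} (d ∷ e ∷ []) eq)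
        with u , d′ , rs ← simulate (λ i → seen (there (here i))) d
           | v , e′ , rt ← simulate (λ i → seen (there (there (here i)))) e
           | c , _ , m , eq′ , _ ← mergeᵛ-just s t eq
        with w , eqʷ , r ← concatᵛ-just u v (rank-represents u s rs (cong length m)) =
        w , SLP.op (d′ ∷ e′ ∷ []) eqʷ ,
        trans r (trans (cong₂ (λ g → plug* (const g)) rt rs)
                (trans (sym (expose-plug* c (inner t) (inner s) m)) (cong expose (sym eq′))))

      simulate-seen : ∀ {A v} → Seen A → rhs A ⇓ v →
                      ∃[ w ] (var (suc A) ⇓ᶠ w × Represents w v)
      simulate-seen s d = simulate (λ { here → s }) (var d)

      -- A factor 2 covers the translated right-hand sides; the operation of the new start variable
      -- is charged to the one operation that `0<∣D∣` guarantees.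
      size-bound : ∀ {k} → RootIn k start root-label → SLP.∣_∣ slpᶠ ≤ 3 * ∣_∣
      size-bound r = begin
        suc (sum (map (ops ∘ rhsᶠ) (tabulate suc)))
          ≡⟨ cong (λ ks → suc (sum ks))
               (trans (map-tabulate {n = #vars} suc (ops ∘ rhsᶠ))
                      (sym (map-tabulate id (ops ∘ rhsᶠ ∘ suc)))) ⟩
        suc (sum (map (ops ∘ rhsᶠ ∘ suc) (allFin #vars)))
          ≤⟨ s≤s (sum-map-≤ 2 ops-rhsᶠ (allFin #vars)) ⟩
        1 + 2 * ∣_∣
          ≤⟨ +-monoˡ-≤ (2 * ∣_∣) (0<∣D∣ r) ⟩
        3 * ∣_∣ ∎
        where
        open ≤-Reasoning
        ops-rhsᶠ : ∀ A → ops (rhsᶠ (suc A)) ≤ 2 * ops (rhs A)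
        ops-rhsᶠ A with unseen A
        ... | true  = z≤n
        ... | false = ops-translate (rhs A)

      validᶠ : SLP.Valid slpᶠ
      validᶠ zero with _ , d ← seen-defined seen-start
        with w , d′ , _ ← simulate-seen seen-start d = _ , SLP.var (SLP.op (d′ ∷ []) refl)
      validᶠ (suc A) with unseen A in s
      ... | true with _ , d ← seen-defined seen-start
        with w , d′ , _ ← simulate-seen seen-start d =
        w ,
        SLP.var (subst (λ b → (if b then var (suc start) else translate (rhs A)) ⇓ᶠ w)
                       (sym s) d′)
      ... | false with _ , d ← seen-defined s with w , d′ , _ ← simulate-seen s d = w , d′

-- Memory

-- The effect of `write` on the written array. For literal array numbers `write` reduces to this or
-- to the old array, which is why so many memory conditions below hold by `refl`.
update : (ℕ → ℕ) → ℕ → ℕ → ℕ → ℕ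
update f i v j = if i ≡ᵇ j then v else f j

≡ᵇ-refl : ∀ n → (n ≡ᵇ n) ≡ true
≡ᵇ-refl zero    = refl
≡ᵇ-refl (suc n) = ≡ᵇ-refl n

≡ᵇ-true : ∀ {m n} → (m ≡ᵇ n) ≡ true → m ≡ n
≡ᵇ-true eq = ≡ᵇ⇒≡ _ _ (Equivalence.from T-≡ eq)

<ᵇ-true : ∀ {m n} → m < n → (m <ᵇ n) ≡ true
<ᵇ-true lt = Equivalence.to T-≡ (<⇒<ᵇ lt)

<ᵇ-irrefl : ∀ n → (n <ᵇ n) ≡ false
<ᵇ-irrefl zero    = refl
<ᵇ-irrefl (suc n) = <ᵇ-irrefl n

update-same : ∀ f i v → update f i v i ≡ v
update-same f i v rewrite ≡ᵇ-refl i = refl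

update-other : ∀ f {i} v {j} → i ≢ j → update f i v j ≡ f j
update-other f {i} v {j} i≢j with i ≡ᵇ j in eq
... | true  = contradiction (≡ᵇ-true eq) i≢j
... | false = refl

-- A nested product, so that the words of a token can be read off by pattern matching.
At : (ℕ → ℕ) → ℕ → List ℕ → Set
At f p []       = ⊤
At f p (w ∷ ws) = f p ≡ w × At f (suc p) ws

At-++⁻ˡ : ∀ {f p} us {vs} → At f p (us ++ vs) → At f p us
At-++⁻ˡ []       _        = tt
At-++⁻ˡ (u ∷ us) (e , ats) = e , At-++⁻ˡ us ats

At-∷ : ∀ {us w} ws {p} → At (us at_) p ws → At ((w ∷ us) at_) (suc p) ws
At-∷ []       _         = tt
At-∷ (w ∷ ws) (e , ats) = e , At-∷ ws ats

At-self : ∀ ws → At (ws at_) 0 ws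
At-self []       = tt
At-self (w ∷ ws) = refl , At-∷ ws (At-self ws)

At-snoc : ∀ {f} v ws {p} → At f p ws → At (update f (p + length ws) v) p (ws ++ [ v ])
At-snoc {f} v [] {p} _ rewrite +-identityʳ p = update-same f p v , tt
At-snoc {f} v (w ∷ ws) {p} (e , ats) rewrite +-suc p (length ws) =
  trans (update-other f v (λ eq → <-irrefl (sym eq) (s≤s (m≤m+n p (length ws))))) e ,
  At-snoc v ws ats

At⇒lookup : ∀ {f} ws {p} → At f p ws → ∀ i → f (p + toℕ i) ≡ lookup ws i
At⇒lookup {f} (w ∷ ws) {p} (e , _)  zero    = trans (cong f (+-identityʳ p)) e
At⇒lookup {f} (w ∷ ws) {p} (_ , ats) (suc i) =
  trans (cong f (+-suc p (toℕ i))) (At⇒lookup ws ats i)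

-- Programs and their running times

-- A total-correctness Hoare triple with a time bound, for one given initial memory in place of a
-- precondition.
record Runs (p : Program) (μ : Memory) (T : ℕ) (Q : Memory → Set) : Set where
  constructor runs
  field
    {time}  : ℕ
    {final} : Memory
    halts   : ⟨ p , μ ⟩⇓[ time ] final
    time≤   : time ≤ T
    post    : Q final

private variable
  p q : Program
  μ ν : Memory
  S T : ℕ
  P Q R : Memory → Set
  b : Test
  a : ℕ
  d e : Term

skipped : Q μ → Runs skip μ 1 Q
skipped = runs skip ≤-refl

assigned : Q (write μ a (term μ d) (term μ e)) → Runs (a ! d ≔ e) μ 1 Q
assigned = runs assign ≤-refl

infixr 4 _⨾_

_⨾_ : Runs p μ S R → (∀ {ν} → R ν → Runs q ν T Q) → Runs (p then q) μ (S + T) Q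
runs h s≤ r ⨾ k with runs h′ t≤ q ← k r = runs (h then h′) (+-mono-≤ s≤ t≤) q

-- Unlike `_⨾_`, this hands the concrete new memory to the rest of the program, so that later
-- conditions compute.
assign-then : Runs q (write μ a (term μ d) (term μ e)) T Q →
              Runs (a ! d ≔ e then q) μ (suc T) Q
assign-then (runs h t≤ q) = runs (assign then h) (s≤s t≤) q

consequence : (∀ {ν} → P ν → Q ν) → Runs p μ T P → Runs p μ T Q
consequence k (runs h t≤ q) = runs h t≤ (k q)

branch-true : test μ b ≡ true → Runs p μ T Q → Runs (if b run p else q) μ (suc T) Q
branch-true eq (runs h t≤ q) = runs (if-true eq h) (s≤s t≤) q

branch-false : test μ b ≡ false → Runs q μ T Q → Runs (if b run p else q) μ (suc T) Q
branch-false eq (runs h t≤ q) = runs (if-false eq h) (s≤s t≤) q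

stopped : test μ b ≡ false → Q μ → Runs (while b run p) μ 1 Q
stopped eq = runs (stop eq) ≤-refl

-- Unfolds one iteration. The continuation is where each loop proof below applies its own induction
-- hypothesis.
looped : test μ b ≡ true → Runs p μ S R →
         (∀ {ν} → R ν → Runs (while b run p) ν T Q) →
         Runs (while b run p) μ (suc (S + T)) Q
looped eq (runs h s≤ r) k with runs h′ t≤ q ← k r =
  runs (loop eq h h′) (s≤s (+-mono-≤ s≤ t≤)) q

within : S ≤ T → Runs p μ S Q → Runs p μ T Q
within s≤t (runs h t≤ q) = runs h (≤-trans t≤ s≤t) q

-- Arrays of the compiler: 0 input, 1 output, 2 positions of right-hand sides,
-- 3 links, 4 cursor, 5 counter, 6 length of the output.  Arrays 2 and 3 are
-- indexed by the variables of the FSLP, in which A is numbered suc (toℕ A).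

cursor counter written current argument : Term
cursor   = 4 ! lit 0
counter  = 5 ! lit 0
written  = 6 ! lit 0
current  = 0 ! cursor
argument = 0 ! inc cursor

emit : Term → Program
emit e = 1 ! written ≔ e then 6 ! lit 0 ≔ inc written

emitted : Memory → ℕ → Memory
emitted μ v = write (write μ 1 (μ 6 0) v) 6 0 (suc (μ 6 0))

-- target is the final output, rest the part of it still to be written.
Writing : List ℕ → List ℕ → Memory → Set
Writing target rest μ =
  ∃[ ws ] (At (μ 1) 0 ws × μ 6 0 ≡ length ws × ws ++ rest ≡ target)

writing-emitted : ∀ {target rest v v′} → v′ ≡ v → Writing target (v ∷ rest) μ →
                  Writing target rest (emitted μ v′)
writing-emitted {μ = μ} {rest = rest} {v} refl (ws , ats , len , eq) =
  ws ++ [ v ] ,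
  subst (λ k → At (update (μ 1) k v) 0 (ws ++ [ v ])) (sym len) (At-snoc v ws ats) ,
  trans (cong suc len) (trans (+-comm 1 _) (sym (length-++ ws))) ,
  trans (++-assoc ws [ v ] rest) eq

emit-last : ∀ {target rest v} → term μ e ≡ v → Writing target (v ∷ rest) μ →
            (Writing target rest (emitted μ (term μ e)) → Q (emitted μ (term μ e))) →
            Runs (emit e) μ 2 Q
emit-last {μ = μ} eq w k =
  runs (assign then assign) ≤-refl (k (writing-emitted {μ = μ} eq w))

emit-then : ∀ {target rest v} → term μ e ≡ v → Writing target (v ∷ rest) μ →
            (Writing target rest (emitted μ (term μ e)) →
              Runs q (emitted μ (term μ e)) T Q) →
            Runs (emit e then q) μ (2 + T) Q
emit-then {μ = μ} eq w k with runs h t≤ q ← k (writing-emitted {μ = μ} eq w) =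
  runs ((assign then assign) then h) (s≤s (s≤s t≤)) q

-- Token codes: 1 variable, 2 and 3 leaves a(b), 4 and 5 merges.
dispatch forTokens : Program → Program → Program → Program
dispatch v l m =
  if current == lit 1 run (v then 4 ! lit 0 ≔ inc (inc cursor)) else
  if current ≺ lit 4 run (l then 4 ! lit 0 ≔ inc (inc (inc cursor))) else
  (m then 4 ! lit 0 ≔ inc cursor)
forTokens v l m = while lit 0 ≺ current run dispatch v l m

locateLoop locate : Program
locateLoop =
  while counter ≺ 0 ! lit 0 run
    (5 ! lit 0 ≔ inc counter then
     2 ! counter ≔ cursor then
     forTokens skip skip skip then
     4 ! lit 0 ≔ inc cursor)
-- Words 0 and 1 hold the number of variables and the start variable; right-hand sides begin at word
-- 2.
locate = 4 ! lit 0 ≔ lit 2 then locateLoop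

-- A cell of array 3 is 0 for a variable not yet seen; otherwise it is 1 plus
-- the variable below it on the stack (0 if there is none).  The counter is the
-- top of the stack.
visit searchLoop search : Program
visit =
  if 3 ! inc argument == lit 0
  run (3 ! inc argument ≔ inc counter then 5 ! lit 0 ≔ inc argument)
  else skip
searchLoop =
  while lit 0 ≺ counter run
    (4 ! lit 0 ≔ 2 ! counter then
     5 ! lit 0 ≔ dec (3 ! counter) then
     forTokens visit skip skip)
search =
  3 ! inc (0 ! lit 1) ≔ lit 1 then
  5 ! lit 0 ≔ inc (0 ! lit 1) then
  searchLoop

chaseLoop chase : Program
chaseLoop = while current == lit 1 run (4 ! lit 0 ≔ 2 ! inc argument)
chase     = 4 ! lit 0 ≔ 2 ! inc (0 ! lit 1) then chaseLoop

-- The codes 2 and 3 of a(b) and a(b̲) are also those of ε and x, the code of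
-- b ⟨-⟩ starts with 4, and the codes of concatenations are one above those of
-- merges.  The header written by output ends with the right-hand side a(S).
emitVariable emitLeaf emitMerge emitRule outputLoop output compile : Program
emitVariable = emit (lit 1) then emit (inc argument)
emitLeaf     = emit current then emit (lit 4) then emit (0 ! inc (inc cursor))
emitMerge    = emit (inc current)
emitRule     =
  if 3 ! counter == lit 0
  run (emit (lit 1) then emit (inc (0 ! lit 1)))
  else (4 ! lit 0 ≔ 2 ! counter then forTokens emitVariable emitLeaf emitMerge)
outputLoop =
  while counter ≺ 0 ! lit 0 run
    (5 ! lit 0 ≔ inc counter then
     emitRule then
     emit (lit 0))
output =
  6 ! lit 0 ≔ lit 0 then
  5 ! lit 0 ≔ lit 0 then
  emit (inc (0 ! lit 0)) then
  emit (lit 0) then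
  emit (lit 1) then
  emit (inc (0 ! lit 1)) then
  emit (lit 4) then
  emit argument then
  emit (lit 0) then
  outputLoop
compile = locate then search then chase then output

-- Right-hand sides as sequences of tokens

module Tokens {Σ : Set} {n : ℕ} (labels : Σ ↔ Fin n) where
  open Labelled labels
  open Translation labels

  data Token (N : ℕ) : Set where
    var : Fin N → Token N
    op  : ∀ {k} → ClusterOp k → Token N

  private variable N : ℕ

  mutual
    tokens : Exprᶜ N → List (Token N)
    tokens (var A)   = var A ∷ []
    tokens (op o es) = tokens* es ++ op o ∷ []

    tokens* : ∀ {k} → Vec (Exprᶜ N) k → List (Token N)
    tokens* []       = []
    tokens* (e ∷ es) = tokens e ++ tokens* es

  code codeᶠ : Token N → List ℕ
  code (var A) = 1 ∷ toℕ A ∷ []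
  code (op o)  = clusterCode o

  codeᶠ (var A)         = 1 ∷ suc (toℕ A) ∷ []
  codeᶠ (op (a ⟨ b ⟩))  = 2 ∷ 4 ∷ label b ∷ []
  codeᶠ (op (a ⟨ b ⟩ᵇ)) = 3 ∷ 4 ∷ label b ∷ []
  codeᶠ (op ⊙ʰ)         = 5 ∷ []
  codeᶠ (op ⊙ᵛ)         = 6 ∷ []

  open Encoding {clusterAlgebra} clusterCode using (postfix; postfix*)
  open Encoding {forestAlgebra} forestCode public using () renaming (postfix to postfixᶠ)

  mutual
    postfix-tokens : ∀ (e : Exprᶜ N) → postfix e ≡ concatMap code (tokens e)
    postfix-tokens (var A)   = refl
    postfix-tokens (op o es) = begin
      postfix* es ++ clusterCode o
        ≡⟨ cong₂ _++_ (postfix*-tokens* es) (sym (++-identityʳ _)) ⟩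
      concatMap code (tokens* es) ++ clusterCode o ++ []
        ≡⟨ concatMap-++ code (tokens* es) (op o ∷ []) ⟨
      concatMap code (tokens* es ++ op o ∷ []) ∎
      where open ≡-Reasoning

    postfix*-tokens* : ∀ {k} (es : Vec (Exprᶜ N) k) →
                       postfix* es ≡ concatMap code (tokens* es)
    postfix*-tokens* []       = refl
    postfix*-tokens* (e ∷ es) =
      trans (cong₂ _++_ (postfix-tokens e) (postfix*-tokens* es))
            (sym (concatMap-++ code (tokens e) (tokens* es)))

  merge-tokens : ∀ (ts us : List (Token N)) t →
                 concatMap codeᶠ ((ts ++ us ++ []) ++ t ∷ []) ≡
                 (concatMap codeᶠ ts ++ concatMap codeᶠ us ++ []) ++ codeᶠ t
  merge-tokens ts us t = begin
    concatMap codeᶠ ((ts ++ us ++ []) ++ t ∷ [])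
      ≡⟨ concatMap-++ codeᶠ (ts ++ us ++ []) (t ∷ []) ⟩
    concatMap codeᶠ (ts ++ us ++ []) ++ codeᶠ t ++ []
      ≡⟨ cong₂ _++_ (trans (concatMap-++ codeᶠ ts (us ++ []))
                           (cong (concatMap codeᶠ ts ++_) (concatMap-++ codeᶠ us [])))
                    (++-identityʳ (codeᶠ t)) ⟩
    (concatMap codeᶠ ts ++ concatMap codeᶠ us ++ []) ++ codeᶠ t ∎
    where open ≡-Reasoning

  postfixᶠ-translate : ∀ (e : Exprᶜ N) →
                       postfixᶠ (translate e) ≡ concatMap codeᶠ (tokens e)
  postfixᶠ-translate (var A)              = refl
  postfixᶠ-translate (op (a ⟨ b ⟩) [])    = refl
  postfixᶠ-translate (op (a ⟨ b ⟩ᵇ) [])   = refl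
  postfixᶠ-translate (op ⊙ʰ (d ∷ e ∷ [])) =
    trans (cong₂ (λ us vs → (us ++ vs ++ []) ++ 5 ∷ [])
                 (postfixᶠ-translate d) (postfixᶠ-translate e))
          (sym (merge-tokens (tokens d) (tokens e) (op ⊙ʰ)))
  postfixᶠ-translate (op ⊙ᵛ (d ∷ e ∷ [])) =
    trans (cong₂ (λ us vs → (us ++ vs ++ []) ++ 6 ∷ [])
                 (postfixᶠ-translate d) (postfixᶠ-translate e))
          (sym (merge-tokens (tokens d) (tokens e) (op ⊙ᵛ)))

  mutual
    occursIn⇒∈ : ∀ {e : Exprᶜ N} {A} → A occursIn e → var A ∈ tokens e
    occursIn⇒∈ here      = here refl
    occursIn⇒∈ (there i) = ∈-++⁺ˡ (occursIn⇒∈* i)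

    occursIn⇒∈* : ∀ {k} {es : Vec (Exprᶜ N) k} {A} → Any (A occursIn_) es →
                  var A ∈ tokens* es
    occursIn⇒∈* {es = e ∷ _} (here i)  = ∈-++⁺ˡ (occursIn⇒∈ i)
    occursIn⇒∈* {es = e ∷ _} (there i) = ∈-++⁺ʳ (tokens e) (occursIn⇒∈* i)

  0<length-code : ∀ (t : Token N) → 1 ≤ length (code t)
  0<length-code (var _)          = s≤s z≤n
  0<length-code (op (_ ⟨ _ ⟩))   = s≤s z≤n
  0<length-code (op (_ ⟨ _ ⟩ᵇ))  = s≤s z≤n
  0<length-code (op ⊙ʰ)          = s≤s z≤n
  0<length-code (op ⊙ᵛ)          = s≤s z≤n

  length≤code : ∀ (ts : List (Token N)) → length ts ≤ length (concatMap code ts)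
  length≤code []       = z≤n
  length≤code (t ∷ ts) =
    ≤-trans (+-mono-≤ (0<length-code t) (length≤code ts))
            (≤-reflexive (sym (length-++ (code t))))

  -- The first word decides whether the chase goes on; the second is the variable to follow or else
  -- the root label.
  Leftmost : Fin N ⊎ Σ → List ℕ → Set
  Leftmost (inj₁ B) ws = ∃[ vs ] ws ≡ 1 ∷ toℕ B ∷ vs
  Leftmost (inj₂ a) ws = ∃₂ λ w vs → (w ≡ᵇ 1) ≡ false × ws ≡ w ∷ label a ∷ vs

  leftmost-++ : ∀ (l : Fin N ⊎ Σ) {us} vs → Leftmost l us → Leftmost l (us ++ vs)
  leftmost-++ (inj₁ B) vs (_ , refl)          = _ , refl
  leftmost-++ (inj₂ a) vs (_ , _ , ne , refl) = _ , _ , ne , refl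

  leftmost-postfix : ∀ (e : Exprᶜ N) → Leftmost (leftmost e) (postfix e)
  leftmost-postfix (var B)              = _ , refl
  leftmost-postfix (op (a ⟨ b ⟩) [])    = _ , _ , refl , refl
  leftmost-postfix (op (a ⟨ b ⟩ᵇ) [])   = _ , _ , refl , refl
  leftmost-postfix (op ⊙ʰ (e ∷ d ∷ [])) =
    leftmost-++ (leftmost e) _ (leftmost-++ (leftmost e) _ (leftmost-postfix e))
  leftmost-postfix (op ⊙ᵛ (e ∷ d ∷ [])) =
    leftmost-++ (leftmost e) _ (leftmost-++ (leftmost e) _ (leftmost-postfix e))

  handler : Program → Program → Program → Token N → Program
  handler v l m (var _)         = v
  handler v l m (op (_ ⟨ _ ⟩))  = l
  handler v l m (op (_ ⟨ _ ⟩ᵇ)) = l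
  handler v l m (op ⊙ʰ)         = m
  handler v l m (op ⊙ᵛ)         = m

  -- The proof rule for the token loop, shared by the three scanning phases. The invariant is
  -- required for every cursor value `k`, because `dispatch` moves the cursor after the handler has
  -- run.
  module _ {v l m : Program} {input : ℕ → ℕ} {c : ℕ}
    (J : List (Token N) → Memory → Set)
    (handled : ∀ t {ts μ} → μ 0 ≡ input → At input (μ 4 0) (code t) →
      J (t ∷ ts) μ → Runs (handler v l m t) μ c
        (λ ν → ν 0 ≡ input × ν 4 0 ≡ μ 4 0 × (∀ k → J ts (write ν 4 0 k))))
    where

    At-token : List (Token N) → List ℕ → Memory → Set
    At-token ts ws μ = μ 0 ≡ input × At input (μ 4 0) ws × J ts μ

    dispatched : ∀ t {ts ws μ} → At-token (t ∷ ts) (code t ++ ws) μ →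
      test μ (lit 0 ≺ current) ≡ true ×
      Runs (dispatch v l m) μ (3 + c) (At-token ts ws)
    dispatched (var A) {ws = ws} {μ} (i , (e , e′ , ats) , j) =
      cong (0 <ᵇ_) cur ,
      within (≤-trans (≤-reflexive (cong suc (+-comm c 1))) (n≤1+n (2 + c)))
        (branch-true (cong (_≡ᵇ 1) cur)
          (handled (var A) i (e , e′ , tt) j ⨾ λ (i′ , p , j′) →
           assigned (i′ , subst (λ p → At input (2 + p) ws) (sym p) ats , j′ _)))
      where cur = trans (cong-app i (μ 4 0)) e
    dispatched (op (a ⟨ b ⟩)) {ws = ws} {μ} (i , (e , e′ , e″ , ats) , j) =
      cong (0 <ᵇ_) cur ,
      within (≤-reflexive (cong (2 +_) (+-comm c 1)))
        (branch-false (cong (_≡ᵇ 1) cur) (branch-true (cong (_<ᵇ 4) cur)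
          (handled (op (a ⟨ b ⟩)) i (e , e′ , e″ , tt) j ⨾ λ (i′ , p , j′) →
           assigned (i′ , subst (λ p → At input (3 + p) ws) (sym p) ats , j′ _))))
      where cur = trans (cong-app i (μ 4 0)) e
    dispatched (op (a ⟨ b ⟩ᵇ)) {ws = ws} {μ} (i , (e , e′ , e″ , ats) , j) =
      cong (0 <ᵇ_) cur ,
      within (≤-reflexive (cong (2 +_) (+-comm c 1)))
        (branch-false (cong (_≡ᵇ 1) cur) (branch-true (cong (_<ᵇ 4) cur)
          (handled (op (a ⟨ b ⟩ᵇ)) i (e , e′ , e″ , tt) j ⨾ λ (i′ , p , j′) →
           assigned (i′ , subst (λ p → At input (3 + p) ws) (sym p) ats , j′ _))))
      where cur = trans (cong-app i (μ 4 0)) e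
    dispatched (op ⊙ʰ) {ws = ws} {μ} (i , (e , ats) , j) =
      cong (0 <ᵇ_) cur ,
      within (≤-reflexive (cong (2 +_) (+-comm c 1)))
        (branch-false (cong (_≡ᵇ 1) cur) (branch-false (cong (_<ᵇ 4) cur)
          (handled (op ⊙ʰ) i (e , tt) j ⨾ λ (i′ , p , j′) →
           assigned (i′ , subst (λ p → At input (1 + p) ws) (sym p) ats , j′ _))))
      where cur = trans (cong-app i (μ 4 0)) e
    dispatched (op ⊙ᵛ) {ws = ws} {μ} (i , (e , ats) , j) =
      cong (0 <ᵇ_) cur ,
      within (≤-reflexive (cong (2 +_) (+-comm c 1)))
        (branch-false (cong (_≡ᵇ 1) cur) (branch-false (cong (_<ᵇ 4) cur)
          (handled (op ⊙ᵛ) i (e , tt) j ⨾ λ (i′ , p , j′) →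
           assigned (i′ , subst (λ p → At input (1 + p) ws) (sym p) ats , j′ _))))
      where cur = trans (cong-app i (μ 4 0)) e

    -- Per token: the loop test, at most two tests in `dispatch`, the cursor move and the handler.
    -- Handlers of cost 1, 3 and 6 give the constants 5, 7 and 10 below.
    forTokens-runs : ∀ ts {ws μ} → At-token ts (concatMap code ts ++ 0 ∷ ws) μ →
      Runs (forTokens v l m) μ (suc (length ts * (4 + c))) (At-token [] (0 ∷ ws))
    forTokens-runs [] {μ = μ} ats@(i , (e , _) , _) =
      stopped (cong (0 <ᵇ_) (trans (cong-app i (μ 4 0)) e)) ats
    forTokens-runs (t ∷ ts) {ws} {μ} (i , ats , j)
      with continues , body ← dispatched t
             (i , subst (At input (μ 4 0)) (++-assoc (code t) _ (0 ∷ ws)) ats , j) =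
      within (≤-reflexive (cong suc (+-suc (3 + c) (length ts * (4 + c)))))
        (looped continues body (forTokens-runs ts))

-- The compiler

length-concatMap : ∀ {A B : Set} (f : A → List B) xs →
                   length (concatMap f xs) ≡ sum (map (length ∘ f) xs)
length-concatMap f []       = refl
length-concatMap f (x ∷ xs) =
  trans (length-++ (f x)) (cong (length (f x) +_) (length-concatMap f xs))

sum-tabulate-change : ∀ {n} {f g : Fin n → ℕ} i {d} → f i ≡ d + g i →
                      (∀ j → i ≢ j → f j ≡ g j) →
                      sum (tabulate f) ≡ d + sum (tabulate g)
sum-tabulate-change {f = f} {g} zero {d} eq same =
  trans (cong₂ _+_ eq (sum-tabulate-cong (λ j → same (suc j) λ ())))
        (+-assoc d (g zero) _)
  where
  sum-tabulate-cong : ∀ {n} {f g : Fin n → ℕ} → (∀ j → f j ≡ g j) →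
                      sum (tabulate f) ≡ sum (tabulate g)
  sum-tabulate-cong {zero}  eqs = refl
  sum-tabulate-cong {suc n} eqs = cong₂ _+_ (eqs zero) (sum-tabulate-cong (eqs ∘ suc))
sum-tabulate-change {f = f} {g} (suc i) {d} eq same =
  trans (cong₂ _+_ (same zero λ ())
                   (sum-tabulate-change i eq λ j i≢j → same (suc j) (i≢j ∘ Fin.suc-injective)))
        (arith (g zero) d _)
  where
  arith : ∀ k d l → k + (d + l) ≡ d + (k + l)
  arith = solve-∀

module Compiler {Σ : Set} {n : ℕ} (labels : Σ ↔ Fin n)
                (D : SLP (Labelled.clusterAlgebra labels)) where
  open Labelled labels
  open Translation labels
  open FromTopDag D
  open Tokens labels
  open SLP D

  block : Fin #vars → List ℕ
  block A = concatMap code (tokens (rhs A)) ++ 0 ∷ []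

  blocks : List (Fin #vars) → List ℕ
  blocks = concatMap block

  length-tokens<block : ∀ A → length (tokens (rhs A)) < length (block A)
  length-tokens<block A = begin-strict
    length ts                       ≤⟨ length≤code ts ⟩
    length (concatMap code ts)      <⟨ m<m+n _ (s≤s z≤n) ⟩
    length (concatMap code ts) + 1  ≡⟨ length-++ (concatMap code ts) ⟨
    length (block A)                ∎
    where
    open ≤-Reasoning
    ts = tokens (rhs A)

  -- The `suc` stands for the end marker of the block, which pays for the work done once per
  -- variable.
  budget : ∀ c A As → c * suc (length (tokens (rhs A))) + c * length (blocks As) ≤
                      c * length (blocks (A ∷ As))
  budget c A As = begin
    c * suc (length (tokens (rhs A))) + c * length (blocks As)
      ≤⟨ +-monoˡ-≤ _ (*-monoʳ-≤ c (length-tokens<block A)) ⟩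
    c * length (block A) + c * length (blocks As)
      ≡⟨ *-distribˡ-+ c (length (block A)) (length (blocks As)) ⟨
    c * (length (block A) + length (blocks As))
      ≡⟨ cong (c *_) (length-++ (block A)) ⟨
    c * length (blocks (A ∷ As)) ∎
    where open ≤-Reasoning

  Consecutive : ℕ → List (Fin #vars) → Set
  Consecutive k []       = k ≡ #vars
  Consecutive k (A ∷ As) = toℕ A ≡ k × Consecutive (suc k) As

  consecutive-allFin : Consecutive 0 (allFin #vars)
  consecutive-allFin = consecutive-tabulate id refl (λ _ → refl)
    where
    consecutive-tabulate : ∀ {m k} (f : Fin m → Fin #vars) → k + m ≡ #vars →
                           (∀ i → toℕ (f i) ≡ k + toℕ i) → Consecutive k (tabulate f)
    consecutive-tabulate {zero}  {k} f eq eqs = trans (sym (+-identityʳ k)) eq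
    consecutive-tabulate {suc m} {k} f eq eqs =
      trans (eqs zero) (+-identityʳ k) ,
      consecutive-tabulate (f ∘ suc) (trans (sym (+-suc k m)) eq)
        (λ i → trans (eqs (suc i)) (+-suc k (toℕ i)))

  -- Locating the right-hand sides.

  module Phases (input : ℕ → ℕ) (input-0 : input 0 ≡ #vars) (input-1 : input 1 ≡ toℕ start)
    where

    Located : (ℕ → ℕ) → Fin #vars → Set
    Located pos A = At input (pos (suc (toℕ A))) (block A)

    locate-loop : ∀ As {μ} → Consecutive (μ 5 0) As → μ 0 ≡ input → μ 3 ≡ const 0 →
      At input (μ 4 0) (blocks As) → (∀ B → toℕ B < μ 5 0 → Located (μ 2) B) →
      Runs locateLoop μ (suc (5 * length (blocks As)))
        (λ ν → ν 0 ≡ input × ν 3 ≡ const 0 × (∀ B → Located (ν 2) B))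
    locate-loop [] {μ} k i z _ done =
      stopped (trans (cong₂ _<ᵇ_ k (trans (cong-app i 0) input-0)) (<ᵇ-irrefl #vars))
        (i , z , λ B → done B (subst (toℕ B <_) (sym k) (toℕ<n B)))
    locate-loop (A ∷ As) {μ} (k , ks) i z ats done =
      within time
        (looped (<ᵇ-true {μ 5 0} (subst₂ _<_ k (sym (trans (cong-app i 0) input-0)) (toℕ<n A)))
          (assign-then (assign-then
            (forTokens-runs J handled ts (i , ats′ , refl , z , refl) ⨾
             λ (i′ , (_ , ats″) , p , z′ , c) →
             assigned {Q = λ ν → Consecutive (ν 5 0) As × ν 0 ≡ input × ν 3 ≡ const 0 ×
                                 At input (ν 4 0) (blocks As) ×
                                 (∀ B → toℕ B < ν 5 0 → Located (ν 2) B)}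
               (subst (λ j → Consecutive j As) (sym c) ks , i′ , z′ , ats″ ,
                subst₂ (λ j pos → ∀ B → toℕ B < j → Located pos B) (sym c) (sym p) done′))))
          (λ (ks′ , i′ , z′ , ats″ , done″) → locate-loop As ks′ i′ z′ ats″ done″))
      where
      ts = tokens (rhs A)
      pos′ : ℕ → ℕ
      pos′ = update (μ 2) (suc (μ 5 0)) (μ 4 0)
      J : List (Token #vars) → Memory → Set
      J _ ν = ν 2 ≡ pos′ × ν 3 ≡ const 0 × ν 5 0 ≡ suc (μ 5 0)
      ats′ : At input (μ 4 0) (concatMap code ts ++ 0 ∷ blocks As)
      ats′ = subst (At input (μ 4 0)) (++-assoc (concatMap code ts) (0 ∷ []) (blocks As)) ats
      handled : ∀ (t : Token #vars) {us ν} → ν 0 ≡ input → At input (ν 4 0) (code t) →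
        J (t ∷ us) ν → Runs (handler skip skip skip t) ν 1
          (λ ξ → ξ 0 ≡ input × ξ 4 0 ≡ ν 4 0 × (∀ k → J us (write ξ 4 0 k)))
      handled (var _)         i _ j = skipped (i , refl , λ _ → j)
      handled (op (_ ⟨ _ ⟩))  i _ j = skipped (i , refl , λ _ → j)
      handled (op (_ ⟨ _ ⟩ᵇ)) i _ j = skipped (i , refl , λ _ → j)
      handled (op ⊙ʰ)         i _ j = skipped (i , refl , λ _ → j)
      handled (op ⊙ᵛ)         i _ j = skipped (i , refl , λ _ → j)
      done′ : ∀ B → toℕ B < suc (μ 5 0) → Located pos′ B
      done′ B lt with m≤n⇒m<n∨m≡n (s≤s⁻¹ lt)
      ... | inj₁ B<k = subst (λ p → At input p (block B))
                         (sym (update-other (μ 2) (μ 4 0)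
                                (λ eq → <-irrefl (sym (suc-injective eq)) B<k)))
                         (done B B<k)
      ... | inj₂ B≡k with refl ← toℕ-injective (trans k (sym B≡k)) =
        subst (λ p → At input p (block A))
          (sym (trans (cong (update (μ 2) (suc (μ 5 0)) (μ 4 0)) (cong suc k))
                      (update-same (μ 2) (suc (μ 5 0)) (μ 4 0))))
          (At-++⁻ˡ (block A) ats)
      time : suc (1 + (1 + (suc (length ts * 5) + 1)) + suc (5 * length (blocks As))) ≤
             suc (5 * length (blocks (A ∷ As)))
      time = ≤-trans (≤-reflexive (cong suc (arith (length ts) (length (blocks As)))))
                     (s≤s (budget 5 A As))
        where
        arith : ∀ l k → 1 + (1 + (suc (l * 5) + 1)) + suc (5 * k) ≡ 5 * suc l + 5 * k
        arith = solve-∀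

    locate-runs : ∀ {μ} → μ 0 ≡ input → μ 3 ≡ const 0 → μ 5 0 ≡ 0 →
      At input 2 (blocks (allFin #vars)) →
      Runs locate μ (2 + 5 * length (blocks (allFin #vars)))
        (λ ν → ν 0 ≡ input × ν 3 ≡ const 0 × (∀ B → Located (ν 2) B))
    locate-runs {μ} i z c ats = assign-then
      (locate-loop (allFin #vars)
        (subst (λ k → Consecutive k (allFin #vars)) (sym c) consecutive-allFin) i z ats
        (λ B lt → contradiction (subst (toℕ B <_) c lt) λ ()))

    -- Graph search from the start variable.

    unseen : (ℕ → ℕ) → Fin #vars → Bool
    unseen link A = link (suc (toℕ A)) ≡ᵇ 0

    Seen : (ℕ → ℕ) → Fin #vars → Set
    Seen link A = unseen link A ≡ false

    -- The stack as a linked list inside `link`; `pred` undoes the shift that keeps seen cells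
    -- nonzero. Its elements are seen, so writing to an unseen cell cannot damage it.
    Chain : (ℕ → ℕ) → ℕ → List (Fin #vars) → Set
    Chain link h []       = h ≡ 0
    Chain link h (A ∷ st) =
      h ≡ suc (toℕ A) × Seen link A × Chain link (pred (link (suc (toℕ A)))) st

    -- 7 is the cost of a token in the search: 3 for the handler `visit` and 4 for the loop around
    -- it.
    weight : Fin #vars → ℕ
    weight A = 7 * length (block A)

    -- Marking a variable moves its weight from here to the stack and keeps the total; popping it
    -- releases the weight to pay for the scan.
    unseenWeight : (ℕ → ℕ) → ℕ
    unseenWeight link = sum (tabulate (λ A → if unseen link A then weight A else 0))

    -- st is the stack and ts what remains to be scanned of the current
    -- right-hand side.
    record Search (link : ℕ → ℕ) (h : ℕ) (st : List (Fin #vars))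
                  (ts : List (Token #vars)) (M : ℕ) : Set where
      field
        chain     : Chain link h st
        started   : Seen link start ⊎ var start ∈ ts
        closed    : ∀ {A B} → Seen link A → var B ∈ tokens (rhs A) →
                    Seen link B ⊎ A ∈ st ⊎ var B ∈ ts
        defined   : ∀ {A} → Seen link A → Defined A
        pending   : ∀ {B} → var B ∈ ts → Defined B
        potential : unseenWeight link + sum (map weight st) ≡ M

    skip-seen : ∀ {link h st B ts M} → Seen link B → Search link h st (var B ∷ ts) M →
                Search link h st ts M
    skip-seen {link} {st = st} {B} {ts} seen s = record
      { chain = chain ; started = started′ started ; closed = λ a b → closed′ (closed a b)
      ; defined = defined ; pending = pending ∘ there ; potential = potential }
      where
      open Search s
      started′ : Seen link start ⊎ var start ∈ var B ∷ ts → Seen link start ⊎ var start ∈ ts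
      started′ (inj₁ a)           = inj₁ a
      started′ (inj₂ (here refl)) = inj₁ seen
      started′ (inj₂ (there i))   = inj₂ i
      closed′ : ∀ {A C} → Seen link C ⊎ A ∈ st ⊎ var C ∈ var B ∷ ts →
                Seen link C ⊎ A ∈ st ⊎ var C ∈ ts
      closed′ (inj₁ a)                  = inj₁ a
      closed′ (inj₂ (inj₁ i))           = inj₂ (inj₁ i)
      closed′ (inj₂ (inj₂ (here refl))) = inj₁ seen
      closed′ (inj₂ (inj₂ (there i)))   = inj₂ (inj₂ i)

    skip-op : ∀ {link h st ts M k} {o : ClusterOp k} → Search link h st (op o ∷ ts) M →
              Search link h st ts M
    skip-op {link} {st = st} {ts} {o = o} s = record
      { chain = chain ; started = started′ started ; closed = λ a b → closed′ (closed a b)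
      ; defined = defined ; pending = pending ∘ there ; potential = potential }
      where
      open Search s
      started′ : Seen link start ⊎ var start ∈ op o ∷ ts → Seen link start ⊎ var start ∈ ts
      started′ (inj₁ a)         = inj₁ a
      started′ (inj₂ (there i)) = inj₂ i
      closed′ : ∀ {A C} → Seen link C ⊎ A ∈ st ⊎ var C ∈ op o ∷ ts →
                Seen link C ⊎ A ∈ st ⊎ var C ∈ ts
      closed′ (inj₁ a)                = inj₁ a
      closed′ (inj₂ (inj₁ i))         = inj₂ (inj₁ i)
      closed′ (inj₂ (inj₂ (there i))) = inj₂ (inj₂ i)

    module _ (link : ℕ → ℕ) (B : Fin #vars) (h : ℕ) where

      link⁺ : ℕ → ℕ
      link⁺ = update link (suc (toℕ B)) (suc h)

      seen-new : Seen link⁺ B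
      seen-new rewrite ≡ᵇ-refl (toℕ B) = refl

      seen-⁺ : ∀ {A} → Seen link A → Seen link⁺ A
      seen-⁺ {A} seen with toℕ B ≡ᵇ toℕ A
      ... | true  = refl
      ... | false = seen

      seen-⁻ : ∀ {A} → Seen link⁺ A → B ≡ A ⊎ Seen link A
      seen-⁻ {A} seen with toℕ B ≡ᵇ toℕ A in eq
      ... | true  = inj₁ (toℕ-injective (≡ᵇ-true eq))
      ... | false = inj₂ seen

      link⁺-other : ∀ {A} → B ≢ A → link⁺ (suc (toℕ A)) ≡ link (suc (toℕ A))
      link⁺-other B≢A =
        update-other link (suc h) (B≢A ∘ toℕ-injective ∘ suc-injective)

      module _ (new : unseen link B ≡ true) where

        chain⁺ : ∀ st {k} → Chain link k st → Chain link⁺ k st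
        chain⁺ []       eq              = eq
        chain⁺ (A ∷ st) (eq , seen , c) =
          eq , seen-⁺ {A} seen ,
          subst (λ k → Chain link⁺ (pred k) st) (sym (link⁺-other B≢A)) (chain⁺ st c)
          where
          B≢A : B ≢ A
          B≢A refl with () ← trans (sym new) seen

        unseenWeight⁺ : unseenWeight link ≡ weight B + unseenWeight link⁺
        unseenWeight⁺ = sum-tabulate-change B at-B other
          where
          at-B : (if unseen link B then weight B else 0) ≡
                 weight B + (if unseen link⁺ B then weight B else 0)
          at-B rewrite new | seen-new = sym (+-identityʳ (weight B))
          other : ∀ A → B ≢ A → (if unseen link A then weight A else 0) ≡
                                (if unseen link⁺ A then weight A else 0)
          other A B≢A = cong (λ k → if k ≡ᵇ 0 then weight A else 0) (sym (link⁺-other B≢A))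

    -- `k` is the number that the machine reads. Keeping it in the conclusion makes the conclusion
    -- match the memory after the two writes. Successors of `B` may still be unseen, since `B` is
    -- now on the stack.
    mark-new : ∀ {link h st B ts M k} → k ≡ toℕ B → unseen link B ≡ true →
      Search link h st (var B ∷ ts) M →
      Search (update link (suc k) (suc h)) (suc k) (B ∷ st) ts M
    mark-new {link} {h} {st} {B} {ts} refl new s = record
      { chain = refl , seen-new link B h ,
                subst (λ k → Chain (link⁺ link B h) (pred k) st)
                  (sym (update-same link (suc (toℕ B)) (suc h))) (chain⁺ link B h new st chain)
      ; started = started′ started
      ; closed = λ {A} a b → closed′ {A} (seen-⁻ link B h {A} a) b
      ; defined = λ {A} a → defined′ (seen-⁻ link B h {A} a)
      ; pending = pending ∘ there
      ; potential = trans (arith (unseenWeight (link⁺ link B h)) (weight B) _)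
                      (trans (cong (_+ sum (map weight st)) (sym (unseenWeight⁺ link B h new)))
                             potential)
      }
      where
      open Search s
      started′ : Seen link start ⊎ var start ∈ var B ∷ ts →
                 Seen (link⁺ link B h) start ⊎ var start ∈ ts
      started′ (inj₁ a)           = inj₁ (seen-⁺ link B h {start} a)
      started′ (inj₂ (here refl)) = inj₁ (seen-new link B h)
      started′ (inj₂ (there i))   = inj₂ i
      closed′ : ∀ {A C} → B ≡ A ⊎ Seen link A → var C ∈ tokens (rhs A) →
                Seen (link⁺ link B h) C ⊎ A ∈ B ∷ st ⊎ var C ∈ ts
      closed′ (inj₁ refl) i = inj₂ (inj₁ (here refl))
      closed′ {C = C} (inj₂ a) i with closed a i
      ... | inj₁ c                    = inj₁ (seen-⁺ link B h {C} c)
      ... | inj₂ (inj₁ j)             = inj₂ (inj₁ (there j))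
      ... | inj₂ (inj₂ (here refl))   = inj₁ (seen-new link B h)
      ... | inj₂ (inj₂ (there j))     = inj₂ (inj₂ j)
      defined′ : ∀ {A} → B ≡ A ⊎ Seen link A → Defined A
      defined′ (inj₁ refl) = pending (here refl)
      defined′ (inj₂ a)    = defined a
      arith : ∀ u w s → u + (w + s) ≡ (w + u) + s
      arith = solve-∀

    mutual
      -- This is how definedness spreads from the start variable along the search.
      defined-tokens : ∀ {e v B} → e ⇓ v → var B ∈ tokens e → Defined B
      defined-tokens (SLP.var d) (here refl) = _ , d
      defined-tokens (SLP.op {es = es} ds _) i with ∈-++⁻ (tokens* es) i
      ... | inj₁ j         = defined-tokens* ds j
      ... | inj₂ (here ())

      defined-tokens* : ∀ {k} {es : Vec (Exprᶜ #vars) k} {vs B} → Pointwise _⇓_ es vs →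
                        var B ∈ tokens* es → Defined B
      defined-tokens* {es = e ∷ _} (d ∷ ds) i with ∈-++⁻ (tokens e) i
      ... | inj₁ j = defined-tokens d j
      ... | inj₂ j = defined-tokens* ds j

    -- Unseen successors of `A` were excused by its place on the stack; now they are excused by
    -- being among the tokens to be scanned.
    pop : ∀ {link h A st M} → Search link h (A ∷ st) [] M →
          ∃[ M′ ] (weight A + M′ ≡ M × Search link (pred (link h)) st (tokens (rhs A)) M′)
    pop {link} {A = A} {st} s with refl , seen , c ← Search.chain s =
      unseenWeight link + sum (map weight st) ,
      trans (arith (weight A) (unseenWeight link) _) potential ,
      record
      { chain = c
      ; started = started′ started
      ; closed = λ a b → closed′ b (closed a b)
      ; defined = defined
      ; pending = defined-tokens (proj₂ (defined seen))
      ; potential = refl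
      }
      where
      open Search s
      arith : ∀ w u s → w + (u + s) ≡ u + (w + s)
      arith = solve-∀
      started′ : Seen link start ⊎ var start ∈ [] →
                 Seen link start ⊎ var start ∈ tokens (rhs A)
      started′ (inj₁ a) = inj₁ a
      closed′ : ∀ {C B} → var B ∈ tokens (rhs C) →
                Seen link B ⊎ C ∈ A ∷ st ⊎ var B ∈ [] →
                Seen link B ⊎ C ∈ st ⊎ var B ∈ tokens (rhs A)
      closed′ b (inj₁ a)                  = inj₁ a
      closed′ b (inj₂ (inj₁ (here refl))) = inj₂ (inj₂ b)
      closed′ b (inj₂ (inj₁ (there i)))   = inj₂ (inj₁ i)

    Scanning : (pos : ℕ → ℕ) (M : ℕ) → List (Token #vars) → Memory → Set
    Scanning pos M ts μ = μ 2 ≡ pos × ∃[ st ] Search (μ 3) (μ 5 0) st ts M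

    visited : ∀ {pos M} t {ts μ} → μ 0 ≡ input → At input (μ 4 0) (code t) →
      Scanning pos M (t ∷ ts) μ → Runs (handler visit skip skip t) μ 3
        (λ ν → ν 0 ≡ input × ν 4 0 ≡ μ 4 0 × (∀ k → Scanning pos M ts (write ν 4 0 k)))
    visited (var B) {μ = μ} i (_ , e , _) (p , st , s)
      with toℕB ← trans (cong-app i (suc (μ 4 0))) e
      with unseen (μ 3) B in seen
    ... | true =
      branch-true (trans (cong (λ k → μ 3 (suc k) ≡ᵇ 0) toℕB) seen)
        (assign-then (assigned
          (i , refl , λ _ → p , B ∷ st , mark-new toℕB seen s)))
    ... | false =
      branch-false (trans (cong (λ k → μ 3 (suc k) ≡ᵇ 0) toℕB) seen)
        (within (s≤s z≤n) (skipped (i , refl , λ _ → p , st , skip-seen seen s)))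
    visited (op (_ ⟨ _ ⟩)) i _ (p , st , s) =
      within (s≤s z≤n) (skipped (i , refl , λ _ → p , st , skip-op s))
    visited (op (_ ⟨ _ ⟩ᵇ)) i _ (p , st , s) =
      within (s≤s z≤n) (skipped (i , refl , λ _ → p , st , skip-op s))
    visited (op ⊙ʰ) i _ (p , st , s) =
      within (s≤s z≤n) (skipped (i , refl , λ _ → p , st , skip-op s))
    visited (op ⊙ᵛ) i _ (p , st , s) =
      within (s≤s z≤n) (skipped (i , refl , λ _ → p , st , skip-op s))

    Searched : (pos : ℕ → ℕ) → Memory → Set
    Searched pos ν = ν 0 ≡ input × ν 2 ≡ pos × ∃₂ λ h M → Search (ν 3) h [] [] M

    -- The potential `M` bounds the remaining time. It falls with every pop, but not structurally,
    -- so the recursion is on `fuel`.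
    search-loop : ∀ {pos} → (∀ A → Located pos A) → ∀ fuel {μ st M} → M ≤ fuel →
      μ 0 ≡ input → μ 2 ≡ pos → Search (μ 3) (μ 5 0) st [] M →
      Runs searchLoop μ (suc M) (Searched pos)
    search-loop located fuel {st = []} M≤ i p s =
      within (s≤s z≤n)
        (stopped (cong (0 <ᵇ_) (Search.chain s)) (i , p , _ , _ , s))
    search-loop {pos} located fuel {μ} {A ∷ st} {M} M≤ i p s with pop s
    ... | M′ , eq , s′ = continue fuel (≤-trans decrease M≤)
      where
      ts = tokens (rhs A)
      top : μ 5 0 ≡ suc (toℕ A)
      top = proj₁ (Search.chain s)
      decrease : M′ < M
      decrease = begin-strict
        M′                      <⟨ m<n+m M′ (s≤s z≤n) ⟩
        7 * suc (length ts) + M′ ≤⟨ +-monoˡ-≤ M′ (*-monoʳ-≤ 7 (length-tokens<block A)) ⟩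
        weight A + M′           ≡⟨ eq ⟩
        M                       ∎
        where open ≤-Reasoning
      time : suc ((2 + suc (length ts * 7)) + suc M′) ≤ suc M
      time = s≤s (begin
        -- Besides its tokens an iteration costs 4 steps; 3 more round this up to the 7 that the end
        -- marker pays.
        (2 + suc (length ts * 7)) + suc M′      ≤⟨ m≤n+m _ 3 ⟩
        3 + ((2 + suc (length ts * 7)) + suc M′) ≡⟨ arith (length ts) M′ ⟩
        7 * suc (length ts) + M′  ≤⟨ +-monoˡ-≤ M′ (*-monoʳ-≤ 7 (length-tokens<block A)) ⟩
        weight A + M′             ≡⟨ eq ⟩
        M                         ∎)
        where
        open ≤-Reasoning
        arith : ∀ l k → 3 + ((2 + suc (l * 7)) + suc k) ≡ 7 * suc l + k
        arith = solve-∀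
      located-A : At input (μ 2 (μ 5 0)) (block A)
      located-A = subst₂ (λ f k → At input (f k) (block A)) (sym p) (sym top) (located A)
      continue : ∀ fuel → M′ < fuel →
        Runs searchLoop μ (suc M) (Searched pos)
      continue (suc fuel) (s≤s M′≤) =
        within time
          (looped (cong (0 <ᵇ_) top)
            (assign-then (assign-then
              (forTokens-runs (Scanning pos M′) visited ts
                (i , located-A , p , st , s′))))
            (λ (i′ , _ , p′ , _ , s″) → search-loop located fuel M′≤ i′ p′ s″))

    -- Initialisation is viewed as scanning a fictitious right-hand side `start` with an empty
    -- stack, so that `mark-new` also produces the first invariant.
    unseen-all : ∀ {M} → sum (tabulate weight) ≡ M → (∃[ v ] (var start ⇓ v)) →
                 Search (const 0) 0 [] (var start ∷ []) M
    unseen-all eq (_ , SLP.var d) = record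
      { chain = refl ; started = inj₂ (here refl) ; closed = λ () ; defined = λ ()
      ; pending = λ { (here refl) → _ , d } ; potential = trans (+-identityʳ _) eq }

    search-runs : ∀ {pos μ} → (∃[ v ] (var start ⇓ v)) → (∀ A → Located pos A) →
      μ 0 ≡ input → μ 2 ≡ pos → μ 3 ≡ const 0 →
      Runs search μ (3 + sum (tabulate weight)) (Searched pos)
    search-runs {μ = μ} d located i p z =
      assign-then (assign-then (search-loop located _ ≤-refl i p
        (mark-new (trans (cong-app i 1) input-1) (cong (_≡ᵇ 0) (cong-app z _))
          (subst (λ f → Search f 0 [] _ _) (sym z) (unseen-all refl d)))))

    -- Finding the root label and writing the FSLP.

    module Output (pos link : ℕ → ℕ) (located : ∀ A → Located pos A) where

      Fixed : Memory → Set
      Fixed μ = μ 0 ≡ input × μ 2 ≡ pos × μ 3 ≡ link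

      leftmost-block : ∀ A → Leftmost (leftmost (rhs A)) (block A)
      leftmost-block A = leftmost-++ (leftmost (rhs A)) (0 ∷ [])
        (subst (Leftmost _) (postfix-tokens (rhs A)) (leftmost-postfix (rhs A)))

      chase-loop : ∀ {k A a μ} → RootIn k A a → Fixed μ → At input (μ 4 0) (block A) →
        Runs chaseLoop μ (suc (k * 2))
          (λ ν → Fixed ν × ν 0 (suc (ν 4 0)) ≡ label a)
      chase-loop {A = A} {μ = μ} (found eq) fix@(i , _) ats
        with _ , _ , ne , eq′ ← subst (λ l → Leftmost l (block A)) eq (leftmost-block A)
        with e , e′ , _ ← subst (At input (μ 4 0)) eq′ ats =
        within (s≤s z≤n)
          (stopped (trans (cong (_≡ᵇ 1) (trans (cong-app i (μ 4 0)) e)) ne)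
            (fix , trans (cong-app i (suc (μ 4 0))) e′))
      chase-loop {A = A} {μ = μ} (follow {B = B} eq r) fix@(i , p , _) ats
        with _ , eq′ ← subst (λ l → Leftmost l (block A)) eq (leftmost-block A)
        with e , e′ , _ ← subst (At input (μ 4 0)) eq′ ats =
        looped (cong (_≡ᵇ 1) (trans (cong-app i (μ 4 0)) e))
          (assigned {Q = λ ν → Fixed ν × At input (ν 4 0) (block B)}
            (fix , subst₂ (λ f k → At input (f (suc k)) (block B))
                     (sym p) (sym (trans (cong-app i (suc (μ 4 0))) e′)) (located B)))
          (λ (fix′ , ats′) → chase-loop r fix′ ats′)

      chase-runs : ∀ {k a μ} → RootIn k start a → Fixed μ →
        Runs chase μ (2 + k * 2) (λ ν → Fixed ν × ν 0 (suc (ν 4 0)) ≡ label a)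
      chase-runs r fix@(i , p , _) = assign-then (chase-loop r fix
        (subst₂ (λ f k → At input (f (suc k)) (block start))
          (sym p) (sym (trans (cong-app i 1) input-1)) (located start)))

      rule blockᶠ : Fin #vars → List ℕ
      rule A   = if unseen link A then 1 ∷ suc (toℕ start) ∷ []
                 else concatMap codeᶠ (tokens (rhs A))
      blockᶠ A = rule A ++ 0 ∷ []

      Emitting : List ℕ → ℕ → List ℕ → List (Token #vars) → Memory → Set
      Emitting target k ws ts ν =
        ν 2 ≡ pos × ν 3 ≡ link × ν 5 0 ≡ k × Writing target (concatMap codeᶠ ts ++ ws) ν

      emitted-token : ∀ {target k ws} t {ts μ} → μ 0 ≡ input → At input (μ 4 0) (code t) →
        Emitting target k ws (t ∷ ts) μ →
        Runs (handler emitVariable emitLeaf emitMerge t) μ 6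
          (λ ν → ν 0 ≡ input × ν 4 0 ≡ μ 4 0 × (∀ j → Emitting target k ws ts (write ν 4 0 j)))
      emitted-token (var B) {μ = μ} i (_ , e , _) (p , l , c , w) =
        within (m≤m+n 4 2)
          (emit-then refl w λ w₁ →
           emit-last (cong suc (trans (cong-app i (suc (μ 4 0))) e)) w₁ λ w₂ →
           i , refl , λ _ → p , l , c , w₂)
      emitted-token (op (a ⟨ b ⟩)) {μ = μ} i (e , _ , e″ , _) (p , l , c , w) =
        emit-then (trans (cong-app i (μ 4 0)) e) w λ w₁ →
        emit-then refl w₁ λ w₂ →
        emit-last (trans (cong-app i (2 + μ 4 0)) e″) w₂ λ w₃ →
        i , refl , λ _ → p , l , c , w₃
      emitted-token (op (a ⟨ b ⟩ᵇ)) {μ = μ} i (e , _ , e″ , _) (p , l , c , w) =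
        emit-then (trans (cong-app i (μ 4 0)) e) w λ w₁ →
        emit-then refl w₁ λ w₂ →
        emit-last (trans (cong-app i (2 + μ 4 0)) e″) w₂ λ w₃ →
        i , refl , λ _ → p , l , c , w₃
      emitted-token (op ⊙ʰ) {μ = μ} i (e , _) (p , l , c , w) =
        within (m≤m+n 2 4)
          (emit-last (cong suc (trans (cong-app i (μ 4 0)) e)) w λ w₁ →
           i , refl , λ _ → p , l , c , w₁)
      emitted-token (op ⊙ᵛ) {μ = μ} i (e , _) (p , l , c , w) =
        within (m≤m+n 2 4)
          (emit-last (cong suc (trans (cong-app i (μ 4 0)) e)) w λ w₁ →
           i , refl , λ _ → p , l , c , w₁)

      emitRule-runs : ∀ {target ws A μ} → Fixed μ → μ 5 0 ≡ suc (toℕ A) →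
        Writing target (rule A ++ ws) μ →
        Runs emitRule μ (5 + length (tokens (rhs A)) * 10)
          (λ ν → Fixed ν × ν 5 0 ≡ suc (toℕ A) × Writing target ws ν)
      emitRule-runs {target} {ws} {A} {μ} (i , p , l) c w with unseen link A in u
      ... | true =
        branch-true (trans (cong₂ (λ f k → f k ≡ᵇ 0) l c) u)
          (within (m≤m+n 4 _)
            (emit-then refl w λ w₁ →
             emit-last (cong suc (trans (cong-app i 1) input-1)) w₁ λ w₂ →
             (i , p , l) , c , w₂))
      ... | false =
        branch-false (trans (cong₂ (λ f k → f k ≡ᵇ 0) l c) u)
          (within (≤-trans (n≤1+n _) (n≤1+n _))
            (assign-then (consequence
              (λ (i′ , _ , p′ , l′ , c′ , w′) → (i′ , p′ , l′) , c′ , w′)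
              (forTokens-runs (Emitting target (suc (toℕ A)) ws) emitted-token
                (tokens (rhs A))
                (i ,
                 subst₂ (λ f k → At input (f k) (block A)) (sym p) (sym c) (located A) ,
                 p , l , c , w)))))

      output-loop : ∀ {target} As {μ} → Consecutive (μ 5 0) As → Fixed μ →
        Writing target (concatMap blockᶠ As) μ →
        Runs outputLoop μ (suc (10 * length (blocks As))) (Writing target [])
      output-loop [] k (i , _) w =
        stopped (trans (cong₂ _<ᵇ_ k (trans (cong-app i 0) input-0)) (<ᵇ-irrefl #vars)) w
      output-loop {target} (A ∷ As) {μ} (k , ks) fix@(i , _) w =
        within time
          (looped {R = λ ν → Fixed ν × ν 5 0 ≡ suc (toℕ A) ×
                            Writing target (concatMap blockᶠ As) ν}
            (<ᵇ-true {μ 5 0} (subst₂ _<_ k (sym (trans (cong-app i 0) input-0)) (toℕ<n A)))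
            (assign-then
              (emitRule-runs fix (cong suc (sym k))
                (subst (λ ws → Writing target ws μ) (++-assoc (rule A) _ _) w)
               ⨾ λ (fix′ , c , w₁) → emit-last refl w₁ λ w₂ → fix′ , c , w₂))
            (λ (fix′ , c , w₂) →
              output-loop As
                (subst (λ j → Consecutive j As) (trans (cong suc (sym k)) (sym c)) ks) fix′ w₂))
        where
        time : suc ((1 + ((5 + length (tokens (rhs A)) * 10) + 2)) +
                    suc (10 * length (blocks As))) ≤
               suc (10 * length (blocks (A ∷ As)))
        time = s≤s (≤-trans (n≤1+n _)
          (≤-trans (≤-reflexive (arith (length (tokens (rhs A))) (length (blocks As))))
                   (budget 10 A As)))
          where
          arith : ∀ l k → 1 + ((1 + ((5 + l * 10) + 2)) + suc (10 * k)) ≡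
                          10 * suc l + 10 * k
          arith = solve-∀

      compiled : Σ → List ℕ
      compiled a = suc #vars ∷ 0 ∷ 1 ∷ suc (toℕ start) ∷ 4 ∷ label a ∷ 0 ∷
                   concatMap blockᶠ (allFin #vars)

      output-runs : ∀ {a μ} → Fixed μ → μ 0 (suc (μ 4 0)) ≡ label a →
        Runs output μ (17 + 10 * length (blocks (allFin #vars))) (Writing (compiled a) [])
      output-runs {a} {μ} fix@(i , _) lab =
        assign-then (assign-then
          -- The output is empty here because its length has just been reset, so the earlier phases
          -- carry no invariant about arrays 1 and 6.
          (emit-then (cong suc (trans (cong-app i 0) input-0)) ([] , tt , refl , refl) λ w₁ →
           emit-then refl w₁ λ w₂ →
           emit-then refl w₂ λ w₃ →
           emit-then (cong suc (trans (cong-app i 1) input-1)) w₃ λ w₄ →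
           emit-then refl w₄ λ w₅ →
           emit-then lab w₅ λ w₆ →
           emit-then refl w₆ λ w₇ →
           output-loop (allFin #vars) consecutive-allFin fix w₇))

-- Correctness and running time of the compiler.

module Correctness {Σ : Set} {n : ℕ} (labels : Σ ↔ Fin n)
                   (D : Labelled.TopDag labels) where
  open Labelled labels
  open Translation labels
  open TopDag D
  open FromTopDag slp
  open Tokens labels
  open Compiler labels slp

  input : ℕ → ℕ
  input = encodeTopDag D at_

  open Phases input refl refl

  root-label : Σ
  root-label = proj₁ (root start)

  root-in : RootIn #vars start root-label
  root-in = proj₂ (root start)

  L : ℕ
  L = length (blocks (allFin #vars))

  encode≡ : encodeTopDag D ≡ #vars ∷ toℕ start ∷ blocks (allFin #vars)
  encode≡ = cong (λ ws → #vars ∷ toℕ start ∷ ws)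
    (concatMap-cong (λ A → cong (_++ 0 ∷ []) (postfix-tokens (rhs A))) (allFin #vars))

  located-input : At input 2 (blocks (allFin #vars))
  located-input = subst (λ ws → At (ws at_) 2 (blocks (allFin #vars))) (sym encode≡)
    (At-∷ _ (At-∷ _ (At-self _)))

  weights≤ : sum (tabulate weight) ≤ 7 * L
  weights≤ = begin
    sum (tabulate weight)
      ≡⟨ cong sum (map-tabulate id weight) ⟨
    sum (map weight (allFin #vars))
      ≤⟨ sum-map-≤ 7 (λ _ → ≤-refl) (allFin #vars) ⟩
    7 * sum (map (length ∘ block) (allFin #vars))
      ≡⟨ cong (7 *_) (length-concatMap block (allFin #vars)) ⟨
    7 * L ∎
    where open ≤-Reasoning

  #vars≤ : #vars ≤ L
  #vars≤ = ≤-trans (≤-reflexive (sym (length-tabulate {n = #vars} id)))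
                   (length≤blocks (allFin #vars))
    where
    length≤blocks : ∀ As → length As ≤ length (blocks As)
    length≤blocks []       = z≤n
    length≤blocks (A ∷ As) = ≤-trans
      (+-mono-≤ (≤-trans (s≤s z≤n) (length-tokens<block A)) (length≤blocks As))
      (≤-reflexive (sym (length-++ (block A))))

  -- 24 = 5 + 7 + 2 + 10 steps per word for locating, searching, chasing and writing. The additive
  -- constants also sum to 24 and are covered by the two header words, with 24 to spare.
  time : (2 + 5 * L) + ((3 + sum (tabulate weight)) + ((2 + #vars * 2) + (17 + 10 * L))) ≤
         24 * length (encodeTopDag D)
  time = begin
    (2 + 5 * L) + ((3 + sum (tabulate weight)) + ((2 + #vars * 2) + (17 + 10 * L)))
      ≤⟨ +-monoʳ-≤ (2 + 5 * L) (+-mono-≤ (+-monoʳ-≤ 3 weights≤)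
           (+-monoˡ-≤ (17 + 10 * L) (+-monoʳ-≤ 2 (*-monoˡ-≤ 2 #vars≤)))) ⟩
    (2 + 5 * L) + ((3 + 7 * L) + ((2 + L * 2) + (17 + 10 * L)))
      ≤⟨ m≤m+n _ 24 ⟩
    ((2 + 5 * L) + ((3 + 7 * L) + ((2 + L * 2) + (17 + 10 * L)))) + 24
      ≡⟨ arith L ⟩
    24 * (2 + L)
      ≡⟨ cong (λ ws → 24 * length ws) encode≡ ⟨
    24 * length (encodeTopDag D) ∎
    where
    open ≤-Reasoning
    arith : ∀ l → ((2 + 5 * l) + ((3 + 7 * l) + ((2 + l * 2) + (17 + 10 * l)))) + 24 ≡
                  24 * (2 + l)
    arith = solve-∀

  Compiled : Memory → Set
  Compiled ν = ∃[ F ] ((FSLP.value F ≡ [ value ] × FSLP.∣_∣ F ≤ 3 * ∣_∣) ×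
                       ν outputs encodeFSLP F)

  rooted-result : Rooted root-label result
  rooted-result with evaluates
  ... | SLP.var d = rooted root-in d

  -- With the stack and the tokens exhausted, the alternatives in `started` and `closed` vanish and
  -- the hypotheses of `FSLPOf` remain.
  module _ (pos link : ℕ → ℕ) (located : ∀ A → Located pos A)
           {h M} (search : Search link h [] [] M) where
    open Output pos link located

    seen-start : Seen link start
    seen-start with inj₁ s ← Search.started search = s

    seen-closed : ∀ {A B} → Seen link A → B occursIn rhs A → Seen link B
    seen-closed {A} s i with Search.closed search {A} s (occursIn⇒∈ i)
    ... | inj₁ s′        = s′
    ... | inj₂ (inj₁ ())
    ... | inj₂ (inj₂ ())

    open FSLPOf root-label (unseen link) seen-start
      (λ {A} → seen-closed {A}) (λ {A} → Search.defined search {A})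

    start-value : ∃[ w ] (var (suc start) ⇓ᶠ w × Represents w result)
    start-value with evaluates
    ... | SLP.var d = simulate-seen {start} seen-start d

    fslp : FSLP
    fslp = record
      { slp       = slpᶠ
      ; valid     = validᶠ
      ; value     = [ value ]
      ; result    = _
      ; evaluates = SLP.var (SLP.op (proj₁ (proj₂ start-value) ∷ []) refl)
      ; agrees    = cong [_] root-agrees
      }
      where
      root-agrees : node root-label (𝓕.forest (proj₁ start-value)) ≡ embed value
      root-agrees
        with value≡ , inner≡ ← embed-children (trans (sym agrees) rooted-result) = begin
        node root-label (𝓕.forest (proj₁ start-value))
          ≡⟨ cong (node root-label) (proj₂ (proj₂ start-value)) ⟩
        node root-label (expose (inner result))
          ≡⟨ cong (node root-label ∘ expose) inner≡ ⟩
        node root-label (expose (embed* (children value)))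
          ≡⟨ cong (node root-label) (plug*-embed* _ (children value)) ⟩
        embed (node root-label (children value))
          ≡⟨ cong embed value≡ ⟨
        embed value ∎
        where open ≡-Reasoning

    encodedRule : Fin (suc #vars) → List ℕ
    encodedRule A = postfixᶠ (rhsᶠ A) ++ 0 ∷ []

    encodedRules : concatMap encodedRule (tabulate {n = #vars} suc) ≡
                   concatMap blockᶠ (allFin #vars)
    encodedRules = begin
      concatMap encodedRule (tabulate {n = #vars} suc)
        ≡⟨ cong (concatMap encodedRule) (map-tabulate {n = #vars} id Fin.suc) ⟨
      concatMap encodedRule (map Fin.suc (allFin #vars))
        ≡⟨ concatMap-map encodedRule Fin.suc (allFin #vars) ⟩
      concatMap (encodedRule ∘ suc) (allFin #vars)
        ≡⟨ concatMap-cong (λ A → cong (_++ 0 ∷ []) (rule≡ A)) (allFin #vars) ⟩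
      concatMap blockᶠ (allFin #vars) ∎
      where
      open ≡-Reasoning
      rule≡ : ∀ A → postfixᶠ (rhsᶠ (suc A)) ≡ rule A
      rule≡ A with unseen link A
      ... | true  = refl
      ... | false = postfixᶠ-translate (rhs A)

    encode-fslp : encodeFSLP fslp ≡ compiled root-label
    encode-fslp =
      cong (λ ws → suc #vars ∷ 0 ∷ 1 ∷ suc (toℕ start) ∷ 4 ∷ label root-label ∷ 0 ∷ ws)
           encodedRules

    fslp-size : FSLP.∣_∣ fslp ≤ 3 * ∣_∣
    fslp-size = size-bound root-in

    writing⇒compiled : ∀ {ν} → Writing (compiled root-label) [] ν → Compiled ν
    writing⇒compiled {ν} (ws , ats , _ , eq) =
      fslp , (refl , fslp-size) , At⇒lookup (encodeFSLP fslp) (subst (At (ν 1) 0) ws≡ ats)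
      where
      ws≡ : ws ≡ encodeFSLP fslp
      ws≡ = trans (sym (++-identityʳ ws)) (trans eq (sym encode-fslp))

  compile-runs : Runs compile (initial (encodeTopDag D))
                      (24 * length (encodeTopDag D)) Compiled
  compile-runs = within time
    (locate-runs refl refl refl located-input ⨾ λ {μ} (i , z , located) →
     search-runs (_ , evaluates) located i refl z ⨾ λ {ν} (i , p , _ , _ , s) →
     -- Arrays 2 and 3 are frozen as left by the locating and the searching phase; from here on they
     -- are only read.
     Output.chase-runs (μ 2) (ν 3) located root-in (i , p , refl) ⨾ λ (fix , lab) →
     consequence (λ {ξ} → writing⇒compiled (μ 2) (ν 3) located s {ξ})
       (Output.output-runs (μ 2) (ν 3) located fix lab))

computed : ∀ {B : Set} {encodeᴮ : B → List ℕ} {R : B → Set} →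
  Runs p μ T (λ ν → ∃[ b ] (R b × ν outputs encodeᴮ b)) →
  ∃[ b ] (R b × ∃[ t ] ∃[ ν ] (⟨ p , μ ⟩⇓[ t ] ν × t ≤ T × ν outputs encodeᴮ b))
computed (runs halts time≤ (b , r , outputs)) = b , r , _ , _ , halts , time≤ , outputs

proposition3 : ∀ {Σ : Set} {n : ℕ} (labels : Σ ↔ Fin n) →
    let open Labelled labels in
    ∃[ k ] LinearTimeComputable encodeTopDag encodeFSLP
    (λ D F → FSLP.value F ≡ [ TopDag.value D ] ×
    FSLP.∣_∣ F ≤ k * TopDag.∣_∣ D)
proposition3 labels =
  3 , compile , 24 , λ D → computed (Correctness.compile-runs labels D)
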